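{- For every integer $n \geq 0$ and every integer $\ell \geq 1$, both $P^\ell_n$ and $C^\ell_n$ have unimodal domination sequences; that is, for $G \in \{P^\ell_n, C^\ell_n\}$ the sequence $(\gamma_k(G))_{k\geq 0}$ is unimodal.
   Context: A dominating set in a graph $G$ is a set $D$ of vertices such that every vertex of $G$ is in $D$ or adjacent to a vertex of $D$. $\gamma_k(G)$ denotes the number of dominating sets of $G$ of size $k$; the sequence $(\gamma_k(G))_{k \geq 0}$ is the domination sequence of $G$. A sequence $(a_k)_{k\geq 0}$ is unimodal if there is an index $m$ with $a_0 \leq a_1 \leq \cdots \leq a_m \geq a_{m+1} \geq a_{m+2} \geq \cdots$. For a graph $G$ and positive integer $\ell$, the $\ell$th power of $G$ is the graph on the same vertex set in which two distinct vertices are adjacent iff their distance in $G$ is at most $\ell$. $P^\ell_n$ is the $\ell$th power of the path on $n$ vertices and $C^\ell_n$ is the $\ell$th power of the cycle on $n$ vertices. By convention $P^\ell_0$ and $C^\ell_0$ are the graph with no vertices (which has exactly one dominating set, the empty set), $C^\ell_1$ is a single isolated vertex, and $C^\ell_2$ is the complete graph on two vertices. -}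

module Defs where

open import Data.Nat using (ℕ; zero; suc; _+_; _∸_; _≤_; _<_; _≤ᵇ_; _≡ᵇ_)
open import Data.Nat.Base using (∣_-_∣; _⊓_)
open import Data.Bool using (Bool; true; false; _∧_; _∨_; not; if_then_else_)
open import Data.Fin using (Fin; toℕ)
open import Data.Fin.Subset using (Subset; ∣_∣)
open import Data.Vec using (Vec; []; _∷_; lookup)
import Data.List
open import Data.List using (List; []; _∷_; map; _++_)
open import Data.Fin using (_≟_)
open import Data.Product using (∃; _×_)
open import Relation.Nullary.Decidable using (does)
open import Relation.Binary.PropositionalEquality using (_≡_)

Graph : ℕ → Set
Graph n = Fin n → Fin n → Bool

pathDist : ∀ {n} → Fin n → Fin n → ℕ
pathDist i j = ∣ toℕ i - toℕ j ∣

cycleDist : ∀ {n} → Fin n → Fin n → ℕ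
cycleDist {n} i j = ∣ toℕ i - toℕ j ∣ ⊓ (n ∸ ∣ toℕ i - toℕ j ∣)

powerOf : ∀ {n} → (Fin n → Fin n → ℕ) → ℕ → Graph n
powerOf d ℓ i j = not (does (i ≟ j)) ∧ (d i j ≤ᵇ ℓ)

P : (ℓ n : ℕ) → Graph n
P ℓ n = powerOf {n} pathDist ℓ

C : (ℓ n : ℕ) → Graph n
C ℓ n = powerOf {n} cycleDist ℓ

allFin : ∀ n → List (Fin n)
allFin n = Data.List.allFin n

anyL : ∀ {A : Set} → (A → Bool) → List A → Bool
anyL p []       = false
anyL p (x ∷ xs) = p x ∨ anyL p xs

allL : ∀ {A : Set} → (A → Bool) → List A → Bool
allL p []       = true
allL p (x ∷ xs) = p x ∧ allL p xs

isDominating : ∀ {n} → Graph n → Subset n → Bool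
isDominating {n} G D =
  allL (λ v → lookup D v ∨ anyL (λ u → lookup D u ∧ G v u) (allFin n)) (allFin n)

allSubsets : ∀ n → List (Subset n)
allSubsets zero    = [] ∷ []
allSubsets (suc n) = map (true ∷_) (allSubsets n) ++ map (false ∷_) (allSubsets n)

countL : ∀ {A : Set} → (A → Bool) → List A → ℕ
countL p []       = 0
countL p (x ∷ xs) = if p x then suc (countL p xs) else countL p xs

γ : ∀ {n} → Graph n → ℕ → ℕ
γ {n} G k = countL (λ D → isDominating G D ∧ (∣ D ∣ ≡ᵇ k)) (allSubsets n)

Unimodal : (ℕ → ℕ) → Set
Unimodal a = ∃ λ m → (∀ i → suc i ≤ m → a i ≤ a (suc i))
                   × (∀ i → m ≤ i → a (suc i) ≤ a i)

{-# OPTIONS --safe #-}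

-- A set D dominates the ℓ-th power of a path or cycle iff the gaps between consecutive elements of
-- D are at most 2ℓ+1 (at most ℓ vertices precede the first and follow the last element of a path).
-- Hence D is a composition of n with parts in [1 , 2ℓ+1], with modified end parts for the path.
--
-- Path: the kernels counting such compositions with k and k+1 parts form a pair that is totally
-- positive of order 2 in n; convolution with a window preserves this, and log-concavity in k follows.
--
-- Cycle: with c k the number of compositions of n into k parts, the number d k of dominating k-sets
-- satisfies k · d k = n · c k.  Exchanging tails of a pair of compositions gives
-- c (k-1) · c (k+1) + w k ≤ (c k)², where w k counts the pairs in which no partial sum of the first
-- composition exceeds that of the second.  By the cycle lemma every pair has such a rotation, so
-- (c k)² ≤ k · w k, which is precisely the gain needed to make c k / k log-concave.
module Submission where

open import Data.Bool using (Bool; true; false; if_then_else_; T; _∧_; _∨_; not)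
open import Data.Bool.Properties using (∧-zeroʳ; ∨-zeroʳ)
open import Data.Empty using (⊥)
open import Data.Fin using (Fin; zero; suc; toℕ; fromℕ<; _≟_)
open import Data.Fin.Properties using (toℕ<n; toℕ-fromℕ<)
open import Data.Fin.Subset using (Subset; ∣_∣)
open import Data.List using (List; []; _∷_; length; map; _++_)
open import Data.List.Membership.Propositional using (_∈_)
open import Data.List.Membership.Propositional.Properties using (∈-allFin)
open import Data.List.Properties using (++-assoc; ++-identityʳ; length-++)
open import Data.List.Relation.Unary.Any using (here; there)
open import Data.Nat hiding (_≟_)
open import Data.Nat.Properties hiding (_≟_)
open import Data.Nat.Tactic.RingSolver using (solve; solve-∀)
open import Data.Product using (∃-syntax; _×_; _,_; proj₁; proj₂)
open import Data.Sum using (_⊎_; inj₁; inj₂)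
open import Data.Vec using (Vec; lookup) renaming ([] to []ᵛ; _∷_ to _∷ᵛ_)
open import Defs
open import Function using (_∘_)
open import Relation.Binary.PropositionalEquality
open import Relation.Nullary using (¬_; yes; no; contradiction; does)

-- A linear inequality a ≤ b is certified by a sum x ≤ y of hypotheses and a slack s.
lin : ∀ s {x y a b} → x ≤ y → a + y + s ≡ b + x → a ≤ b
lin s {x} {y} {a} {b} h e =
  +-cancelʳ-≤ y a b (≤-trans (m≤m+n (a + y) s) (≤-trans (≤-reflexive e) (+-monoʳ-≤ b h)))

-- Finite sums and convolution with a window

∑ : ℕ → (ℕ → ℕ) → ℕ
∑ zero    f = 0
∑ (suc n) f = f 0 + ∑ n (f ∘ suc)

∑-cong : ∀ n {f g} → (∀ i → f i ≡ g i) → ∑ n f ≡ ∑ n g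
∑-cong zero    e = refl
∑-cong (suc n) e = cong₂ _+_ (e 0) (∑-cong n (e ∘ suc))

∑-mono : ∀ n {f g} → (∀ i → i < n → f i ≤ g i) → ∑ n f ≤ ∑ n g
∑-mono zero    h = z≤n
∑-mono (suc n) h = +-mono-≤ (h 0 z<s) (∑-mono n λ i p → h (suc i) (s≤s p))

∑-zero : ∀ n → ∑ n (λ _ → 0) ≡ 0
∑-zero zero    = refl
∑-zero (suc n) = ∑-zero n

∑-+ : ∀ n f g → ∑ n (λ i → f i + g i) ≡ ∑ n f + ∑ n g
∑-+ zero    f g = refl
∑-+ (suc n) f g = begin
  f 0 + g 0 + ∑ n (λ i → f (suc i) + g (suc i))       ≡⟨ cong (f 0 + g 0 +_) (∑-+ n (f ∘ suc) (g ∘ suc)) ⟩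
  f 0 + g 0 + (∑ n (f ∘ suc) + ∑ n (g ∘ suc))         ≡⟨ interchange (f 0) (g 0) (∑ n (f ∘ suc)) (∑ n (g ∘ suc)) ⟩
  f 0 + ∑ n (f ∘ suc) + (g 0 + ∑ n (g ∘ suc))         ∎
  where
  open ≡-Reasoning
  interchange : ∀ a b c d → a + b + (c + d) ≡ a + c + (b + d)
  interchange = solve-∀

∑-*ˡ : ∀ n c f → ∑ n (λ i → c * f i) ≡ c * ∑ n f
∑-*ˡ zero    c f = sym (*-zeroʳ c)
∑-*ˡ (suc n) c f = trans (cong (c * f 0 +_) (∑-*ˡ n c (f ∘ suc))) (sym (*-distribˡ-+ c (f 0) _))

∑-*ʳ : ∀ n c f → ∑ n (λ i → f i * c) ≡ ∑ n f * c
∑-*ʳ zero    c f = refl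
∑-*ʳ (suc n) c f = trans (cong (f 0 * c +_) (∑-*ʳ n c (f ∘ suc))) (sym (*-distribʳ-+ c (f 0) _))

∑-swap : ∀ m n (f : ℕ → ℕ → ℕ) → ∑ m (λ i → ∑ n (f i)) ≡ ∑ n (λ j → ∑ m (λ i → f i j))
∑-swap zero    n f = sym (∑-zero n)
∑-swap (suc m) n f = trans (cong (∑ n (f 0) +_) (∑-swap m n (f ∘ suc)))
                           (sym (∑-+ n (f 0) (λ j → ∑ m (λ i → f (suc i) j))))

∑-split : ∀ m n f → ∑ (m + n) f ≡ ∑ m f + ∑ n (λ i → f (m + i))
∑-split zero    n f = refl
∑-split (suc m) n f = trans (cong (f 0 +_) (∑-split m n (f ∘ suc))) (sym (+-assoc (f 0) _ _))

∑-term : ∀ n f {i} → i < n → f i ≤ ∑ n f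
∑-term (suc n) f {zero}  _       = m≤m+n (f 0) _
∑-term (suc n) f {suc i} (s≤s p) = ≤-trans (∑-term n (f ∘ suc) p) (m≤n+m _ (f 0))

∑-positive : ∀ n f → 0 < ∑ n f → ∃[ i ] i < n × 0 < f i
∑-positive (suc n) f p with f 0 in e
... | suc _ = 0 , z<s , subst (0 <_) (sym e) z<s
... | zero  with ∑-positive n (f ∘ suc) p
...   | i , i<n , q = suc i , s≤s i<n , q

-- The range [a , b) is half-open, and empty if b ≤ a.
S : (ℕ → ℕ) → ℕ → ℕ → ℕ
S f a b = ∑ (b ∸ a) (λ i → f (a + i))

S-mono : ∀ {f g} a b → (∀ x → a ≤ x → x < b → f x ≤ g x) → S f a b ≤ S g a b
S-mono a b h = ∑-mono (b ∸ a) λ i p → h (a + i) (m≤m+n a i) (m<n∸o⇒o+m<n p)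
  where
  m<n∸o⇒o+m<n : ∀ {i a b} → i < b ∸ a → a + i < b
  m<n∸o⇒o+m<n {i} {zero}          p = p
  m<n∸o⇒o+m<n {i} {suc a} {suc b} p = s≤s (m<n∸o⇒o+m<n {i} {a} p)

S-+ : ∀ f g a b → S (λ x → f x + g x) a b ≡ S f a b + S g a b
S-+ f g a b = ∑-+ (b ∸ a) _ _

S-*ˡ : ∀ c f a b → S (λ x → c * f x) a b ≡ c * S f a b
S-*ˡ c f a b = ∑-*ˡ (b ∸ a) c _

S-*ʳ : ∀ c f a b → S (λ x → f x * c) a b ≡ S f a b * c
S-*ʳ c f a b = ∑-*ʳ (b ∸ a) c _

S-split : ∀ f {a m b} → a ≤ m → m ≤ b → S f a b ≡ S f a m + S f m b
S-split f {a} {m} {b} a≤m m≤b = begin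
  ∑ (b ∸ a) (λ i → f (a + i))                                   ≡⟨ cong (λ k → ∑ k (λ i → f (a + i))) (lengths a≤m m≤b) ⟩
  ∑ ((m ∸ a) + (b ∸ m)) (λ i → f (a + i))                       ≡⟨ ∑-split (m ∸ a) (b ∸ m) _ ⟩
  S f a m + ∑ (b ∸ m) (λ i → f (a + ((m ∸ a) + i)))             ≡⟨ cong (S f a m +_) (∑-cong (b ∸ m) λ i → cong f (shiftIndex i)) ⟩
  S f a m + S f m b                                             ∎
  where
  open ≡-Reasoning
  lengths : ∀ {a m b} → a ≤ m → m ≤ b → b ∸ a ≡ (m ∸ a) + (b ∸ m)
  lengths z≤n q = sym (m+[n∸m]≡n q)
  lengths (s≤s p) (s≤s q) = lengths p q
  shiftIndex : ∀ i → a + ((m ∸ a) + i) ≡ m + i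
  shiftIndex i = trans (sym (+-assoc a (m ∸ a) i)) (cong (_+ i) (m+[n∸m]≡n a≤m))

S-empty : ∀ f a → S f a a ≡ 0
S-empty f a rewrite n∸n≡0 a = refl

S-term : ∀ f {a x b} → a ≤ x → x < b → f x ≤ S f a b
S-term f {a} {x} {b} a≤x x<b = subst (λ y → f y ≤ S f a b) (m+[n∸m]≡n a≤x)
  (∑-term (b ∸ a) (λ i → f (a + i)) (∸-monoˡ-< x<b a≤x))

S-positive : ∀ f a b → 0 < S f a b → ∃[ x ] a ≤ x × x < b × 0 < f x
S-positive f a b p with ∑-positive (b ∸ a) _ p
... | i , i<n , q = a + i , m≤m+n a i , bound a b i<n , q
  where
  bound : ∀ a b → i < b ∸ a → a + i < b
  bound zero    b       p = p
  bound (suc a) (suc b) p = s≤s (bound a b p)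

-- On generating functions `shift s` is multiplication by `x^s`, and `conv M` below is
-- multiplication by `x + x^2 + ... + x^M`.
shift : ℕ → (ℕ → ℕ) → ℕ → ℕ
shift zero    h n       = h n
shift (suc s) h zero    = 0
shift (suc s) h (suc n) = shift s h n

conv : ℕ → (ℕ → ℕ) → ℕ → ℕ
conv M h n = ∑ M (λ i → shift (suc i) h n)

-- Truncated subtraction cuts the window off at 0, in agreement with the shifts exceeding `n`, which
-- contribute 0.
conv-window : ∀ M h n → conv M h n ≡ S h (n ∸ M) n
conv-window M       h zero    rewrite 0∸n≡0 M = ∑-zero M
conv-window zero    h (suc n) = sym (S-empty h (suc n))
conv-window (suc M) h (suc n) = begin
  h n + conv M h n               ≡⟨ cong (h n +_) (conv-window M h n) ⟩
  h n + S h (n ∸ M) n            ≡⟨ +-comm (h n) _ ⟩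
  S h (n ∸ M) n + h n            ≡⟨ cong (S h (n ∸ M) n +_) (sym singleton) ⟩
  S h (n ∸ M) n + S h n (suc n)  ≡⟨ sym (S-split h (m∸n≤m n M) (n≤1+n n)) ⟩
  S h (n ∸ M) (suc n)            ∎
  where
  open ≡-Reasoning
  singleton : S h n (suc n) ≡ h n
  singleton rewrite m+n∸n≡m 1 n | +-identityʳ n = +-identityʳ (h n)

shift-cong : ∀ s {f g} → (∀ m → f m ≡ g m) → ∀ n → shift s f n ≡ shift s g n
shift-cong zero    e n       = e n
shift-cong (suc s) e zero    = refl
shift-cong (suc s) e (suc n) = shift-cong s e n

conv-cong : ∀ M {f g} → (∀ m → f m ≡ g m) → ∀ n → conv M f n ≡ conv M g n
conv-cong M e n = ∑-cong M λ i → shift-cong (suc i) e n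

shift-∑ : ∀ s K (h : ℕ → ℕ → ℕ) n → shift s (λ m → ∑ K (λ j → h j m)) n ≡ ∑ K (λ j → shift s (h j) n)
shift-∑ zero    K h n       = refl
shift-∑ (suc s) K h zero    = sym (∑-zero K)
shift-∑ (suc s) K h (suc n) = shift-∑ s K h n

shift-*ˡ : ∀ s c h n → shift s (λ m → c * h m) n ≡ c * shift s h n
shift-*ˡ zero    c h n       = refl
shift-*ˡ (suc s) c h zero    = sym (*-zeroʳ c)
shift-*ˡ (suc s) c h (suc n) = shift-*ˡ s c h n

shift-*ʳ : ∀ s c h n → shift s (λ m → h m * c) n ≡ shift s h n * c
shift-*ʳ zero    c h n       = refl
shift-*ʳ (suc s) c h zero    = refl
shift-*ʳ (suc s) c h (suc n) = shift-*ʳ s c h n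

shift-+ : ∀ s t h n → shift s (shift t h) n ≡ shift (s + t) h n
shift-+ zero    t h n       = refl
shift-+ (suc s) t h zero    = refl
shift-+ (suc s) t h (suc n) = shift-+ s t h n

shift-comm : ∀ s t h n → shift s (shift t h) n ≡ shift t (shift s h) n
shift-comm s t h n =
  trans (shift-+ s t h n) (trans (cong (λ r → shift r h n) (+-comm s t)) (sym (shift-+ t s h n)))

conv-∑ : ∀ M K (h : ℕ → ℕ → ℕ) n → conv M (λ m → ∑ K (λ j → h j m)) n ≡ ∑ K (λ j → conv M (h j) n)
conv-∑ M K h n = trans (∑-cong M λ i → shift-∑ (suc i) K h n) (∑-swap M K _)

conv-*ˡ : ∀ M c h n → conv M (λ m → c * h m) n ≡ c * conv M h n
conv-*ˡ M c h n = trans (∑-cong M λ i → shift-*ˡ (suc i) c h n) (∑-*ˡ M c _)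

conv-shift : ∀ M s h n → conv M (shift s h) n ≡ shift s (conv M h) n
conv-shift M s h n = trans (∑-cong M λ i → shift-comm (suc i) s h n) (sym (shift-∑ s M _ n))

-- Prepends `k` parts from `[1, M]` to a final piece weighted by `g`.
pow : ℕ → (ℕ → ℕ) → ℕ → ℕ → ℕ
pow M g zero    = g
pow M g (suc k) = conv M (pow M g k)

χ : Bool → ℕ
χ b = if b then 1 else 0

-- Comparing `e + n` with `c`, instead of `n` with `c ∸ e`, makes this vanish identically when `e`
-- exceeds `c`.
ind : ℕ → ℕ → ℕ → ℕ
ind e c n = χ (e + n ≤ᵇ c)

-- Total positivity and log-concavity

-- Total positivity of order 2 of the two-row matrix with rows g and f.
_≽_ : (ℕ → ℕ) → (ℕ → ℕ) → Set
g ≽ f = ∀ {x y} → y ≤ x → f x * g y ≤ g x * f y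

S-product-mono : ∀ (f g f′ g′ : ℕ → ℕ) a b c d →
  (∀ x y → a ≤ x → x < b → c ≤ y → y < d → f x * g y ≤ f′ x * g′ y) →
  S f a b * S g c d ≤ S f′ a b * S g′ c d
S-product-mono f g f′ g′ a b c d h = begin
  S f a b * S g c d               ≡⟨ sym (S-*ˡ (S f a b) g c d) ⟩
  S (λ y → S f a b * g y) c d     ≤⟨ S-mono c d row ⟩
  S (λ y → S f′ a b * g′ y) c d   ≡⟨ S-*ˡ (S f′ a b) g′ c d ⟩
  S f′ a b * S g′ c d             ∎
  where
  open ≤-Reasoning
  row : ∀ y → c ≤ y → y < d → S f a b * g y ≤ S f′ a b * g′ y
  row y c≤y y<d = begin
    S f a b * g y                ≡⟨ sym (S-*ʳ (g y) f a b) ⟩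
    S (λ x → f x * g y) a b      ≤⟨ S-mono a b (λ x a≤x x<b → h x y a≤x x<b c≤y y<d) ⟩
    S (λ x → f′ x * g′ y) a b    ≡⟨ S-*ʳ (g′ y) f′ a b ⟩
    S f′ a b * g′ y              ∎

-- On the overlap [a , d) the two products coincide; the other three blocks are ordered.
≽-windows : ∀ {g f a b c d} → g ≽ f → c ≤ a → d ≤ b →
  S f a b * S g c d ≤ S g a b * S f c d
≽-windows {g} {f} {a} {b} {c} {d} g≽f c≤a d≤b with ≤-total d a
... | inj₁ d≤a = S-product-mono f g g f a b c d λ x y a≤x _ _ y<d → g≽f (≤-trans (<⇒≤ y<d) (≤-trans d≤a a≤x))
... | inj₂ a≤d = begin
  S f a b * S g c d                                   ≡⟨ cong₂ _*_ (S-split f a≤d d≤b) (S-split g c≤a a≤d) ⟩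
  (fO + fX) * (gY + gO)                               ≡⟨ expand fO fX gY gO ⟩
  fO * gY + fO * gO + (fX * gY + fX * gO)             ≤⟨ +-mono-≤ (+-mono-≤ OY (≤-reflexive (*-comm fO gO))) (+-mono-≤ XY XO) ⟩
  gO * fY + gO * fO + (gX * fY + gX * fO)             ≡⟨ sym (expand gO gX fY fO) ⟩
  (gO + gX) * (fY + fO)                               ≡⟨ sym (cong₂ _*_ (S-split g a≤d d≤b) (S-split f c≤a a≤d)) ⟩
  S g a b * S f c d                                   ∎
  where
  open ≤-Reasoning
  fO = S f a d
  gO = S g a d
  fX = S f d b
  gX = S g d b
  fY = S f c a
  gY = S g c a
  expand : ∀ o x y p → (o + x) * (y + p) ≡ o * y + o * p + (x * y + x * p)
  expand = solve-∀
  OY : fO * gY ≤ gO * fY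
  OY = S-product-mono f g g f a d c a λ x y a≤x _ _ y<a → g≽f (≤-trans (<⇒≤ y<a) a≤x)
  XY : fX * gY ≤ gX * fY
  XY = S-product-mono f g g f d b c a λ x y d≤x _ _ y<a → g≽f (≤-trans (<⇒≤ y<a) (≤-trans a≤d d≤x))
  XO : fX * gO ≤ gX * fO
  XO = S-product-mono f g g f d b a d λ x y d≤x _ _ y<d → g≽f (≤-trans (<⇒≤ y<d) d≤x)

-- Passing from `y` to `x` moves both ends of the window weakly to the right, as `≽-windows`
-- demands; truncation at 0 preserves this.
conv-≽ : ∀ M {g f} → g ≽ f → conv M g ≽ conv M f
conv-≽ M {g} {f} g≽f {x} {y} y≤x
  rewrite conv-window M f x | conv-window M f y | conv-window M g x | conv-window M g y
  = ≽-windows {g} {f} g≽f (∸-monoˡ-≤ M y≤x) y≤x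

≤ᵇ-true : ∀ {m n} → m ≤ n → (m ≤ᵇ n) ≡ true
≤ᵇ-true {m} {n} m≤n with m ≤ᵇ n in e
... | true  = refl
... | false = contradiction (≤⇒≤ᵇ m≤n) (subst (T) e)

≤ᵇ-false : ∀ {m n} → n < m → (m ≤ᵇ n) ≡ false
≤ᵇ-false {m} {n} n<m with m ≤ᵇ n in e
... | false = refl
... | true  = contradiction (≤ᵇ⇒≤ m n (subst T (sym e) _)) (<⇒≱ n<m)

ind-one : ∀ {e c n} → e + n ≤ c → ind e c n ≡ 1
ind-one p = cong χ (≤ᵇ-true p)

ind-zero : ∀ {e c n} → c < e + n → ind e c n ≡ 0
ind-zero p = cong χ (≤ᵇ-false p)

-- In the base case a nonzero indicator at `x` forces `x ≤ c ≤ M`, so the window reaches down to 0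
-- and `conv` is a prefix sum, which grows with its argument. `conv-≽` does the rest.
pow-≽ : ∀ {e c M} → c ≤ M → ∀ k → pow M (ind e c) (suc k) ≽ pow M (ind e c) k
pow-≽ {e} {c} {M} c≤M (suc k) = conv-≽ M (pow-≽ {e} {c} c≤M k)
pow-≽ {e} {c} {M} c≤M zero {x} {y} y≤x with e + x ≤? c
... | no  p rewrite ind-zero {e} {c} {x} (≰⇒> p) = z≤n
... | yes p rewrite ind-one {e} {c} {x} p | ind-one {e} {c} {y} (≤-trans (+-monoʳ-≤ e y≤x) p) = begin
    1 * conv M h y             ≡⟨ *-identityˡ _ ⟩
    conv M h y                 ≡⟨ full (≤-trans y≤x x≤M) ⟩
    S h 0 y                    ≤⟨ m≤m+n _ _ ⟩
    S h 0 y + S h y x          ≡⟨ sym (S-split h z≤n y≤x) ⟩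
    S h 0 x                    ≡⟨ sym (full x≤M) ⟩
    conv M h x                 ≡⟨ sym (*-identityʳ _) ⟩
    conv M h x * 1             ∎
  where
  open ≤-Reasoning
  h = ind e c
  x≤M : x ≤ M
  x≤M = ≤-trans (m≤n+m x e) (≤-trans p c≤M)
  full : ∀ {z} → z ≤ M → conv M h z ≡ S h 0 z
  full {z} z≤M = trans (conv-window M h z) (cong (λ a → S h a z) (m≤n⇒m∸n≡0 z≤M))

-- The remaining windows of the two factors are [n ∸ L , n) and [v ∸ M , v).
conv-logConcave : ∀ {g f M L} n → g ≽ f → L ≤ M →
  conv L f n * conv L (conv M g) n ≤ conv L g n * conv L (conv M f) n
conv-logConcave {g} {f} {M} {L} n g≽f L≤M
  rewrite conv-window L f n | conv-window L g n
        | conv-window L (conv M g) n | conv-window L (conv M f) n = begin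
  A * S (conv M g) (n ∸ L) n            ≡⟨ sym (S-*ˡ A (conv M g) (n ∸ L) n) ⟩
  S (λ v → A * conv M g v) (n ∸ L) n    ≤⟨ S-mono (n ∸ L) n row ⟩
  S (λ v → B * conv M f v) (n ∸ L) n    ≡⟨ S-*ˡ B (conv M f) (n ∸ L) n ⟩
  B * S (conv M f) (n ∸ L) n            ∎
  where
  open ≤-Reasoning
  A = S f (n ∸ L) n
  B = S g (n ∸ L) n
  row : ∀ v → n ∸ L ≤ v → v < n → A * conv M g v ≤ B * conv M f v
  row v _ v<n rewrite conv-window M f v | conv-window M g v =
    ≽-windows {g} {f} g≽f (∸-mono (<⇒≤ v<n) L≤M) (<⇒≤ v<n)

-- Supports of the kernels

conv-term : ∀ {M h n x} → n ∸ M ≤ x → x < n → h x ≤ conv M h n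
conv-term {M} {h} {n} p q rewrite conv-window M h n = S-term h p q

conv-positive : ∀ M h n → 0 < conv M h n → ∃[ x ] n ∸ M ≤ x × x < n × 0 < h x
conv-positive M h n p = S-positive h (n ∸ M) n (subst (0 <_) (conv-window M h n) p)

-- Meant for consecutive kernels, with `k` and `k + 1` parts. `next` rules out internal zeros in the
-- number of parts; `first` is the witness that carries `next` through a convolution.
record Supported (k : ℕ) (h h′ : ℕ → ℕ) : Set where
  field
    above : ∀ x → 0 < h x → k ≤ x
    next  : ∀ x → 0 < h x → k < x → 0 < h′ x
    first : 0 < h′ (suc k)

conv-next : ∀ {k h h′} M → Supported k h h′ → ∀ x → 0 < conv M h x → suc k < x → 0 < conv M h′ x
conv-next {k} {h} {h′} M s x p k<x with conv-positive M h x p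
... | v , lo , hi , q with k <? v
...   | yes k<v = <-≤-trans (Supported.next s v q k<v) (conv-term {M} lo hi)
-- The witness `v` is at most `k`; since `suc k < x`, the window also contains `suc k`, where
-- `first` applies.
...   | no  k≮v = <-≤-trans (Supported.first s)
                    (conv-term {M} (≤-trans lo (≤-trans (≮⇒≥ k≮v) (n≤1+n k))) k<x)

conv-supported : ∀ {k h h′} M → 0 < M → Supported k h h′ → Supported (suc k) (conv M h) (conv M h′)
conv-supported {k} {h} {h′} M M>0 s = record
  { above = λ x p → let v , _ , v<x , q = conv-positive M h x p in ≤-trans (s≤s (Supported.above s v q)) v<x
  ; next  = conv-next M s
  ; first = <-≤-trans (Supported.first s) (conv-term {M} (∸-monoʳ-≤ (suc (suc k)) M>0) ≤-refl)
  }

pow-supported : ∀ {e c M} → e ≤ c → 0 < M → ∀ k →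
  Supported k (pow M (ind e c) k) (pow M (ind e c) (suc k))
pow-supported {e} {c} {M} e≤c M>0 (suc k) = conv-supported M M>0 (pow-supported e≤c M>0 k)
pow-supported {e} {c} {suc M} e≤c M>0 zero = record
  { above = λ _ _ → z≤n
  ; next  = λ { (suc x) p _ → ≤-trans p (≤-trans (antitone x) (m≤m+n (ind e c x) _)) }
  ; first = ≤-trans (≤-reflexive (sym (ind-one {e} {c} {0} (≤-trans (≤-reflexive (+-identityʳ e)) e≤c)))) (m≤m+n _ _)
  }
  where
  antitone : ∀ x → ind e c (suc x) ≤ ind e c x
  antitone x with e + suc x ≤? c
  ... | no  p rewrite ind-zero {e} {c} {suc x} (≰⇒> p) = z≤n
  ... | yes p rewrite ind-one {e} {c} {suc x} p | ind-one {e} {c} {x} (≤-trans (+-monoʳ-≤ e (n≤1+n x)) p) = ≤-refl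

-- Words of pairs and the cycle lemma

Pairs : Set
Pairs = List (ℕ × ℕ)

∑∑ : ℕ → (ℕ × ℕ → ℕ) → ℕ
∑∑ M f = ∑ M (λ j → ∑ M (λ i → f (suc i , suc j)))

∑∑-cong : ∀ M {f g} → (∀ x → f x ≡ g x) → ∑∑ M f ≡ ∑∑ M g
∑∑-cong M e = ∑-cong M λ j → ∑-cong M λ i → e (suc i , suc j)

∑∑-∑ : ∀ M K (f : ℕ → ℕ × ℕ → ℕ) → ∑∑ M (λ x → ∑ K (λ r → f r x)) ≡ ∑ K (λ r → ∑∑ M (f r))
∑∑-∑ M K f = trans (∑-cong M λ j → ∑-swap M K _) (∑-swap M K _)

∑∑-swap : ∀ M (f : ℕ × ℕ → ℕ × ℕ → ℕ) →
  ∑∑ M (λ x → ∑∑ M (f x)) ≡ ∑∑ M (λ y → ∑∑ M (λ x → f x y))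
∑∑-swap M f = trans (∑∑-∑ M M λ j x → ∑ M λ i → f x (suc i , suc j))
  (∑-cong M λ j → ∑∑-∑ M M λ i x → f x (suc i , suc j))

∑words : ℕ → ℕ → (Pairs → ℕ) → ℕ
∑words M zero    F = F []
∑words M (suc k) F = ∑∑ M (λ x → ∑words M k (λ l → F (x ∷ l)))

∑words-mono : ∀ M k {F F′} → (∀ l → length l ≡ k → F l ≤ F′ l) → ∑words M k F ≤ ∑words M k F′
∑words-mono M zero    h = h [] refl
∑words-mono M (suc k) h = ∑-mono M λ j _ → ∑-mono M λ i _ →
  ∑words-mono M k λ l e → h ((suc i , suc j) ∷ l) (cong suc e)

∑words-∑ : ∀ M k K (F : ℕ → Pairs → ℕ) → ∑words M k (λ l → ∑ K (λ r → F r l)) ≡ ∑ K (λ r → ∑words M k (F r))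
∑words-∑ M zero    K F = refl
∑words-∑ M (suc k) K F = trans (∑∑-cong M λ x → ∑words-∑ M k K λ r l → F r (x ∷ l))
  (∑∑-∑ M K λ r x → ∑words M k λ l → F r (x ∷ l))

∑words-*ˡ : ∀ M k c F → ∑words M k (λ l → c * F l) ≡ c * ∑words M k F
∑words-*ˡ M zero    c F = refl
∑words-*ˡ M (suc k) c F = trans (∑∑-cong M λ x → ∑words-*ˡ M k c λ l → F (x ∷ l))
  (trans (∑-cong M λ j → ∑-*ˡ M c _) (∑-*ˡ M c _))

∑words-zero : ∀ M k → ∑words M k (λ _ → 0) ≡ 0
∑words-zero M k = ∑words-*ˡ M k 0 (λ _ → 0)

∑words-shift : ∀ M k s (H : ℕ → Pairs → ℕ) n →
  ∑words M k (λ l → shift s (λ m → H m l) n) ≡ shift s (λ m → ∑words M k (H m)) n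
∑words-shift M k zero    H n       = refl
∑words-shift M k (suc s) H zero    = ∑words-zero M k
∑words-shift M k (suc s) H (suc n) = ∑words-shift M k s H n

∑words-snoc : ∀ M k F → ∑words M (suc k) F ≡ ∑∑ M (λ x → ∑words M k (λ l → F (l ++ x ∷ [])))
∑words-snoc M zero    F = refl
∑words-snoc M (suc k) F = trans (∑∑-cong M λ x → ∑words-snoc M k (λ l → F (x ∷ l))) 
  (∑∑-swap M λ x y → ∑words M k λ l → F (x ∷ l ++ y ∷ []))

rotate : Pairs → Pairs
rotate []      = []
rotate (x ∷ l) = l ++ x ∷ []

rotations : ℕ → Pairs → Pairs
rotations zero    l = l
rotations (suc r) l = rotations r (rotate l)

∑words-rotate : ∀ M k F → ∑words M k (F ∘ rotate) ≡ ∑words M k F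
∑words-rotate M zero    F = refl
∑words-rotate M (suc k) F = sym (∑words-snoc M k F)

∑words-rotations : ∀ M k r F → ∑words M k (F ∘ rotations r) ≡ ∑words M k F
∑words-rotations M k zero    F = refl
∑words-rotations M k (suc r) F = trans (∑words-rotate M k (F ∘ rotations r)) (∑words-rotations M k r F)

∑-const : ∀ n c → ∑ n (λ _ → c) ≡ n * c
∑-const zero    c = refl
∑-const (suc n) c = cong (c +_) (∑-const n c)

-- Rotation permutes the words of length `k`, so each of the `k` rotations contributes the same sum.
∑words-averaging : ∀ M k F → ∑words M k (λ l → ∑ k (λ r → F (rotations r l))) ≡ k * ∑words M k F
∑words-averaging M k F = begin
  ∑words M k (λ l → ∑ k (λ r → F (rotations r l)))   ≡⟨ ∑words-∑ M k k _ ⟩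
  ∑ k (λ r → ∑words M k (F ∘ rotations r))           ≡⟨ ∑-cong k (λ r → ∑words-rotations M k r F) ⟩
  ∑ k (λ _ → ∑words M k F)                           ≡⟨ ∑-const k _ ⟩
  k * ∑words M k F                                   ∎
  where open ≡-Reasoning

rotations-++ : ∀ p s → rotations (length p) (p ++ s) ≡ s ++ p
rotations-++ []      s = sym (++-identityʳ s)
rotations-++ (x ∷ p) s = begin
  rotations (length p) ((p ++ s) ++ x ∷ []) ≡⟨ cong (rotations (length p)) (++-assoc p s (x ∷ [])) ⟩
  rotations (length p) (p ++ s ++ x ∷ [])   ≡⟨ rotations-++ p (s ++ x ∷ []) ⟩
  (s ++ x ∷ []) ++ p                        ≡⟨ ++-assoc s (x ∷ []) p ⟩
  s ++ x ∷ p                                 ∎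
  where open ≡-Reasoning

-- Pairs of compositions as weighted words

δ : ℕ → ℕ
δ = ind 0 0

module _ (φ : ℕ → ℕ → ℕ) where

  -- The product of φ over the pairs of totals left after each step, if the components of the word
  -- sum to u and v; otherwise 0.
  weight : ℕ → ℕ → Pairs → ℕ
  weight u v []            = δ u * δ v
  weight u v ((s , t) ∷ l) = shift t (λ y → shift s (λ x → φ x y * weight x y l) u) v

  -- Summing over the first letter turns the two shifts of `weight` into nested convolutions, the
  -- second component outermost.
  ∑words-weight : ∀ M k u v → ∑words M (suc k) (weight u v) ≡
    conv M (λ y → conv M (λ x → φ x y * ∑words M k (weight x y)) u) v
  ∑words-weight M k u v = ∑-cong M λ j → begin
    ∑ M (λ i → ∑words M k (λ l → shift (suc j) (λ y → shift (suc i) (λ x → φ x y * weight x y l) u) v))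
      ≡⟨ ∑-cong M (λ i → trans (∑words-shift M k (suc j) _ v) (shift-cong (suc j) (λ y →
           trans (∑words-shift M k (suc i) _ u) (shift-cong (suc i) (λ x → ∑words-*ˡ M k (φ x y) _) u)) v)) ⟩
    ∑ M (λ i → shift (suc j) (λ y → shift (suc i) (λ x → φ x y * ∑words M k (weight x y)) u) v)
      ≡⟨ sym (shift-∑ (suc j) M _ v) ⟩
    shift (suc j) (λ y → conv M (λ x → φ x y * ∑words M k (weight x y)) u) v ∎
    where open ≡-Reasoning

-- Counts compositions into parts from `[1, M]`: `δ` demands that nothing is left over.
comp : ℕ → ℕ → ℕ → ℕ
comp M = pow M δ

free : ℕ → ℕ → ℕ
free _ _ = 1

guard : ℕ → ℕ → ℕ
guard x y = χ (y ≤ᵇ x)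

conv-*ʳ : ∀ M c h n → conv M (λ m → h m * c) n ≡ conv M h n * c
conv-*ʳ M c h n = trans (∑-cong M λ i → shift-*ʳ (suc i) c h n) (∑-*ʳ M c _)

-- The constant factor 1 does not couple the two components, so the sum factorises.
∑words-free : ∀ M k u v → ∑words M k (weight free u v) ≡ comp M k u * comp M k v
∑words-free M zero    u v = refl
∑words-free M (suc k) u v = begin
  ∑words M (suc k) (weight free u v)
    ≡⟨ ∑words-weight free M k u v ⟩
  conv M (λ y → conv M (λ x → 1 * ∑words M k (weight free x y)) u) v
    ≡⟨ conv-cong M (λ y → conv-cong M (λ x → trans (*-identityˡ _) (∑words-free M k x y)) u) v ⟩
  conv M (λ y → conv M (λ x → comp M k x * comp M k y) u) v
    ≡⟨ conv-cong M (λ y → conv-*ʳ M (comp M k y) (comp M k) u) v ⟩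
  conv M (λ y → comp M (suc k) u * comp M k y) v
    ≡⟨ conv-*ˡ M (comp M (suc k) u) (comp M k) v ⟩
  comp M (suc k) u * comp M (suc k) v ∎
  where open ≡-Reasoning

-- The guard compares what is left of `u` and `v` after each step. For `u = v` it says that no
-- partial sum of the first composition exceeds that of the second.
ordered : ℕ → ℕ → ℕ → ℕ → ℕ
ordered M k u v = ∑words M k (weight guard u v)

conv-mono : ∀ M {f g} n → (∀ x → x < n → f x ≤ g x) → conv M f n ≤ conv M g n
conv-mono M {f} {g} n h rewrite conv-window M f n | conv-window M g n =
  S-mono (n ∸ M) n λ x _ x<n → h x x<n

conv-+ : ∀ M f g n → conv M (λ x → f x + g x) n ≡ conv M f n + conv M g n
conv-+ M f g n rewrite conv-window M (λ x → f x + g x) n | conv-window M f n | conv-window M g n =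
  S-+ f g (n ∸ M) n

-- Exchange of tails at the first crossing; switch₁ is the stage at which only the second composition
-- has made its first step.
mutual
  switch : ∀ M k {u v} → v ≤ u →
    ordered M (suc k) u v + comp M k u * comp M (2 + k) v ≤
    comp M (suc k) u * comp M (suc k) v
  switch M k {u} {v} v≤u = begin
    ordered M (suc k) u v + comp M k u * comp M (2 + k) v
      ≡⟨ cong₂ _+_ (∑words-weight guard M k u v) (sym (conv-*ˡ M (comp M k u) (comp M (suc k)) v)) ⟩
    conv M (λ y → conv M (λ x → guard x y * ordered M k x y) u) v
      + conv M (λ y → comp M k u * comp M (suc k) y) v
      ≡⟨ sym (conv-+ M _ _ v) ⟩
    conv M (λ y → conv M (λ x → guard x y * ordered M k x y) u + comp M k u * comp M (suc k) y) v
      ≤⟨ conv-mono M v (λ y y<v → switch₁ M k (<-≤-trans y<v v≤u)) ⟩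
    conv M (λ y → comp M (suc k) u * comp M k y) v
      ≡⟨ conv-*ˡ M (comp M (suc k) u) (comp M k) v ⟩
    comp M (suc k) u * comp M (suc k) v ∎
    where open ≤-Reasoning

  switch₁ : ∀ M k {u y} → y < u →
    conv M (λ x → guard x y * ordered M k x y) u + comp M k u * comp M (suc k) y ≤
    comp M (suc k) u * comp M k y
  -- `comp M 0 (suc u)` computes to 0, so the second summand is gone and only the guard has to be
  -- dropped.
  switch₁ M zero {suc u} {y} y<u = begin
    conv M (λ x → guard x y * (δ x * δ y)) (suc u) + 0   ≡⟨ +-identityʳ _ ⟩
    conv M (λ x → guard x y * (δ x * δ y)) (suc u)       ≤⟨ conv-mono M (suc u) (λ x _ → *-monoˡ-≤ (δ x * δ y) (χ≤1 (y ≤ᵇ x))) ⟩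
    conv M (λ x → 1 * (δ x * δ y)) (suc u)               ≡⟨ conv-cong M (λ x → *-identityˡ _) (suc u) ⟩
    conv M (λ x → δ x * δ y) (suc u)                     ≡⟨ conv-*ʳ M (δ y) δ (suc u) ⟩
    comp M 1 (suc u) * δ y                                  ∎
    where
    open ≤-Reasoning
    χ≤1 : ∀ b → χ b ≤ 1
    χ≤1 true  = ≤-refl
    χ≤1 false = z≤n
  switch₁ M (suc k) {u} {y} y<u = begin
    conv M H u + conv M f u * q              ≡⟨ cong (conv M H u +_) (sym (conv-*ʳ M q f u)) ⟩
    conv M H u + conv M (λ x → f x * q) u    ≡⟨ sym (conv-+ M H _ u) ⟩
    conv M L u                               ≡⟨ conv-window M L u ⟩
    S L a u                                  ≡⟨ S-split L a≤m m≤u ⟩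
    S L a m + S L m u                        ≤⟨ +-mono-≤ low high ⟩
    S R a m + S R m u                        ≡⟨ sym (S-split R a≤m m≤u) ⟩
    S R a u                                  ≡⟨ sym (conv-window M R u) ⟩
    conv M R u                               ≡⟨ conv-*ʳ M p g u ⟩
    conv M g u * p                           ∎
    where
    open ≤-Reasoning
    f = comp M k
    g = comp M (suc k)
    p = comp M (suc k) y
    q = comp M (2 + k) y
    a = u ∸ M
    -- The window is cut at `y`. At or above `y` there is no crossing yet and `switch` applies;
    -- below `y` the guard is 0 and `≽-windows` exchanges the tails. The maximum keeps the cut
    -- inside the window when `y` lies below it.
    m = a ⊔ y
    a≤m : a ≤ m
    a≤m = m≤m⊔n a y
    m≤u : m ≤ u
    m≤u = ⊔-lub (m∸n≤m u M) (<⇒≤ y<u)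
    H L R : ℕ → ℕ
    H x = guard x y * ordered M (suc k) x y
    L x = H x + f x * q
    R x = g x * p
    high : S L m u ≤ S R m u
    high = S-mono m u λ x m≤x _ → pointwise x (≤-trans (m≤n⊔m a y) m≤x)
      where
      pointwise : ∀ x → y ≤ x → L x ≤ R x
      pointwise x y≤x rewrite ≤ᵇ-true y≤x | *-identityˡ (ordered M (suc k) x y) = switch M k y≤x
    low : S L a m ≤ S R a m
    low = begin
      S L a m                  ≤⟨ S-mono a m (λ x a≤x x<m → vanish x a≤x x<m) ⟩
      S (λ x → f x * q) a m    ≡⟨ S-*ʳ q f a m ⟩
      S f a m * q              ≡⟨ cong (S f a m *_) (conv-window M g y) ⟩
      S f a m * S g (y ∸ M) y  ≤⟨ ≽-windows {g} {f} (pow-≽ {0} {0} z≤n k) (∸-monoˡ-≤ M (<⇒≤ y<u)) (m≤n⊔m a y) ⟩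
      S g a m * S f (y ∸ M) y  ≡⟨ cong (S g a m *_) (sym (conv-window M f y)) ⟩
      S g a m * p              ≡⟨ sym (S-*ʳ p g a m) ⟩
      S R a m                  ∎
      where
      vanish : ∀ x → a ≤ x → x < m → L x ≤ f x * q
      vanish x a≤x x<m with ⊔-sel a y
      ... | inj₁ e = contradiction a≤x (<⇒≱ (subst (x <_) e x<m))
      ... | inj₂ e rewrite ≤ᵇ-false (subst (x <_) e x<m) = ≤-refl

-- Rotating a pair of compositions into order

sum₁ sum₂ : Pairs → ℕ
sum₁ []            = 0
sum₁ ((s , t) ∷ l) = s + sum₁ l
sum₂ []            = 0
sum₂ ((s , t) ∷ l) = t + sum₂ l

-- The offsets `α` and `β` stand for the component sums of whatever follows the word, so that the
-- condition on a concatenation splits.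
Suffixes : ℕ → ℕ → Pairs → Set
Suffixes α β []      = β ≤ α
Suffixes α β (x ∷ l) = (sum₂ (x ∷ l) + β ≤ sum₁ (x ∷ l) + α) × Suffixes α β l

Suffixes-head : ∀ {α β} l → Suffixes α β l → sum₂ l + β ≤ sum₁ l + α
Suffixes-head []      h = h
Suffixes-head (x ∷ l) h = proj₁ h

-- Only the difference `α - β` matters; the first hypothesis says, without subtraction, that it does
-- not decrease.
Suffixes-mono : ∀ {α β α′ β′} l → β′ + α ≤ α′ + β → Suffixes α β l → Suffixes α′ β′ l
Suffixes-mono {α} {β} {α′} {β′} []      h p       = lin 0 (+-mono-≤ h p) (solve (α ∷ β ∷ α′ ∷ β′ ∷ []))
Suffixes-mono {α} {β} {α′} {β′} (x ∷ l) h (p , q) = step (sum₂ (x ∷ l)) (sum₁ (x ∷ l)) p , Suffixes-mono l h q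
  where
  step : ∀ b a → b + β ≤ a + α → b + β′ ≤ a + α′
  step b a p = lin 0 (+-mono-≤ h p) (solve (a ∷ b ∷ α ∷ β ∷ α′ ∷ β′ ∷ []))

sum₁-++ : ∀ p s → sum₁ (p ++ s) ≡ sum₁ p + sum₁ s
sum₁-++ []            s = refl
sum₁-++ ((x , _) ∷ p) s = trans (cong (x +_) (sum₁-++ p s)) (sym (+-assoc x _ _))

sum₂-++ : ∀ p s → sum₂ (p ++ s) ≡ sum₂ p + sum₂ s
sum₂-++ []            s = refl
sum₂-++ ((_ , y) ∷ p) s = trans (cong (y +_) (sum₂-++ p s)) (sym (+-assoc y _ _))

Suffixes-++ : ∀ {α β} p s → Suffixes (sum₁ s + α) (sum₂ s + β) p → Suffixes α β s → Suffixes α β (p ++ s)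
Suffixes-++ []      s h       k = k
Suffixes-++ {α} {β} (x ∷ p) s (h , h′) k =
  subst₂ _≤_ (shape (sum₂ (x ∷ p)) (sum₂ s) β (sum₂-++ (x ∷ p) s))
               (shape (sum₁ (x ∷ p)) (sum₁ s) α (sum₁-++ (x ∷ p) s)) h
  , Suffixes-++ p s h′ k
  where
  shape : ∀ a b d {e} → e ≡ a + b → a + (b + d) ≡ e + d
  shape a b d refl = sym (+-assoc a b d)

-- In terms of prefixes of s the last condition reads: the first partial sum never exceeds the second.
extremal-split : ∀ l → ∃[ p ] ∃[ s ] l ≡ p ++ s × Suffixes 0 0 p × Suffixes (sum₂ s) (sum₁ s) s
extremal-split [] = [] , [] , refl , z≤n , z≤n
extremal-split (x@(a , b) ∷ l) with extremal-split l
... | p , s , refl , hp , hs with sum₂ (x ∷ p) ≤? sum₁ (x ∷ p)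
...   | yes q = x ∷ p , s , refl , (+-monoˡ-≤ 0 q , hp) , hs
-- The cut is placed before a suffix minimising `sum₁ - sum₂`. Here the whole word lies strictly
-- lower than `s`, so the cut moves to the front.
...   | no  q = [] , x ∷ p ++ s , refl , z≤n
    , ≤-reflexive (+-comm (sum₂ (x ∷ p ++ s)) _)
    , Suffixes-++ p s (Suffixes-mono p split-p hp) (Suffixes-mono s split-s hs)
    where
    q′ : a + sum₁ p ≤ b + sum₂ p
    q′ = <⇒≤ (≰⇒> q)
    split-s : a + sum₁ (p ++ s) + sum₂ s ≤ b + sum₂ (p ++ s) + sum₁ s
    split-s rewrite sum₁-++ p s | sum₂-++ p s = go (sum₁ p) (sum₂ p) (sum₁ s) (sum₂ s) q′
      where
      go : ∀ x y z w → a + x ≤ b + y → a + (x + z) + w ≤ b + (y + w) + z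
      go x y z w h = lin 0 h (solve (a ∷ b ∷ x ∷ y ∷ z ∷ w ∷ []))
    split-p : sum₂ s + (a + sum₁ (p ++ s)) + 0 ≤ sum₁ s + (b + sum₂ (p ++ s)) + 0
    split-p rewrite sum₁-++ p s | sum₂-++ p s = go (sum₁ p) (sum₂ p) (sum₁ s) (sum₂ s) q′
      where
      go : ∀ x y z w → a + x ≤ b + y → w + (a + (x + z)) + 0 ≤ z + (b + (y + w)) + 0
      go x y z w h = lin 0 h (solve (a ∷ b ∷ x ∷ y ∷ z ∷ w ∷ []))

-- The word is rotated to `s ++ p`. As the total difference is 0, the differences of `p` and `s` are
-- opposite, so minimality of `s` makes every suffix starting inside `s` nonnegative. For empty `s`
-- the rotation number is 0, since `length p` would be out of range.
cycle-lemma : ∀ l → 0 < length l → sum₁ l ≡ sum₂ l → ∃[ r ] r < length l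
  × Suffixes 0 0 (rotations r l) × sum₁ (rotations r l) ≡ sum₁ l × sum₂ (rotations r l) ≡ sum₂ l
cycle-lemma l l>0 e with extremal-split l
... | p , [] , refl , hp , hs = 0 , l>0 , subst (Suffixes 0 0) (sym (++-identityʳ p)) hp , refl , refl
... | p , s@(_ ∷ s′) , refl , hp , hs = length p , r<
    , subst (Suffixes 0 0) (sym (rotations-++ p s)) good
    , trans (cong sum₁ (rotations-++ p s)) (trans (sum₁-++ s p) (trans (+-comm (sum₁ s) _) (sym (sum₁-++ p s))))
    , trans (cong sum₂ (rotations-++ p s)) (trans (sum₂-++ s p) (trans (+-comm (sum₂ s) _) (sym (sum₂-++ p s))))
    where
    r< : length p < length (p ++ s)
    r< rewrite length-++ p {s} = m<m+n (length p) z<s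
    e′ : sum₁ p + sum₁ s ≡ sum₂ p + sum₂ s
    e′ = trans (sym (sum₁-++ p s)) (trans e (sum₂-++ p s))
    good : Suffixes 0 0 (s ++ p)
    good = Suffixes-++ s p (Suffixes-mono s (≤-reflexive (arith (sum₁ p) (sum₂ p) (sum₁ s) (sum₂ s) e′)) hs) hp
      where
      arith : ∀ x y z w → x + z ≡ y + w → y + 0 + w ≡ x + 0 + z
      arith x y z w h = trans (cong (_+ w) (+-identityʳ y)) (trans (sym h) (cong (_+ z) (sym (+-identityʳ x))))

shift-positive : ∀ s h n → 0 < shift s h n → ∃[ m ] n ≡ s + m × 0 < h m
shift-positive zero    h n       p = n , refl , p
shift-positive (suc s) h (suc n) p with shift-positive s h n p
... | m , e , q = m , cong suc e , q

shift-hit : ∀ s h m → shift s h (s + m) ≡ h m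
shift-hit zero    h m = refl
shift-hit (suc s) h m = shift-hit s h m

weight-free : ∀ u v l → 0 < weight free u v l → u ≡ sum₁ l × v ≡ sum₂ l × weight free u v l ≡ 1
weight-free zero zero [] _ = refl , refl , refl
weight-free u v ((s , t) ∷ l) p with shift-positive t _ v p
... | y , refl , p₁ with shift-positive s _ u p₁
...   | x , refl , p₂ with weight-free x y l (subst (0 <_) (*-identityˡ _) p₂)
...     | refl , refl , e = refl , refl
        , trans (shift-hit t _ y) (trans (shift-hit s _ x) (trans (*-identityˡ _) e))

weight-guard : ∀ l → Suffixes 0 0 l → weight guard (sum₁ l) (sum₂ l) l ≡ 1
weight-guard []            _       = refl
weight-guard ((s , t) ∷ l) (_ , h) = begin
  weight guard (s + sum₁ l) (t + sum₂ l) ((s , t) ∷ l)   ≡⟨ shift-hit t _ (sum₂ l) ⟩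
  shift s (λ x → guard x (sum₂ l) * weight guard x (sum₂ l) l) (s + sum₁ l) ≡⟨ shift-hit s _ (sum₁ l) ⟩
  guard (sum₁ l) (sum₂ l) * weight guard (sum₁ l) (sum₂ l) l ≡⟨ cong₂ _*_ (cong χ (≤ᵇ-true below)) (weight-guard l h) ⟩
  1 ∎
  where
  open ≡-Reasoning
  below : sum₂ l ≤ sum₁ l
  below = subst₂ _≤_ (+-identityʳ _) (+-identityʳ _) (Suffixes-head l h)

-- Each pair of compositions of `n` counts 1 on the left, and by `cycle-lemma` at least one of its
-- `k` rotations counts 1 on the right.
square-bound : ∀ M k n → 0 < k → comp M k n * comp M k n ≤ k * ordered M k n n
square-bound M k n k>0 = begin
  comp M k n * comp M k n                                              ≡⟨ sym (∑words-free M k n n) ⟩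
  ∑words M k (weight free n n)                                     ≤⟨ ∑words-mono M k pointwise ⟩
  ∑words M k (λ l → ∑ k (λ r → weight guard n n (rotations r l)))  ≡⟨ ∑words-averaging M k (weight guard n n) ⟩
  k * ordered M k n n                                            ∎
  where
  open ≤-Reasoning
  pointwise : ∀ l → length l ≡ k → weight free n n l ≤ ∑ k (λ r → weight guard n n (rotations r l))
  pointwise l refl with weight free n n l in e
  ... | zero  = z≤n
  ... | suc _ with weight-free n n l (subst (0 <_) (sym e) z<s)
  ...   | n≡A , n≡B , one with cycle-lemma l k>0 (trans (sym n≡A) n≡B)
  ...     | r , r<k , good , eA , eB = begin
            suc _                              ≡⟨ trans (sym e) one ⟩
            1                                  ≡⟨ sym (weight-guard (rotations r l) good) ⟩
            weight guard (sum₁ (rotations r l)) (sum₂ (rotations r l)) (rotations r l)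
              ≡⟨ cong₂ (λ u v → weight guard u v (rotations r l)) (trans eA (sym n≡A)) (trans eB (sym n≡B)) ⟩
            weight guard n n (rotations r l)   ≤⟨ ∑-term (length l) (λ r → weight guard n n (rotations r l)) r<k ⟩
            ∑ (length l) (λ r → weight guard n n (rotations r l)) ∎

-- With `g` the ordered count, `p` the product and `q` the square: `(j+1) p ≤ (j+1) q - (j+1) g ≤
-- (j+1) q - q`.
strong-logConcave : ∀ M j n →
  suc j * (comp M j n * comp M (2 + j) n) ≤ j * (comp M (suc j) n * comp M (suc j) n)
strong-logConcave M j n = arith j (ordered M (suc j) n n)
  (comp M j n * comp M (2 + j) n) (comp M (suc j) n * comp M (suc j) n)
  (switch M j ≤-refl) (square-bound M (suc j) n z<s)
  where
  arith : ∀ j g p q → g + p ≤ q → q ≤ suc j * g → suc j * p ≤ j * q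
  arith j g p q h k = lin 0 (+-mono-≤ scaled k) (solve (j ∷ g ∷ p ∷ q ∷ []))
    where
    scaled : suc j * (g + p) ≤ suc j * q
    scaled = *-monoʳ-≤ (suc j) h

-- From log-concavity to unimodality

module _ {a : ℕ → ℕ} {N : ℕ}
  (beyond : ∀ k → N < k → a k ≡ 0)
  (up     : ∀ k → 0 < a k → k < N → 0 < a (suc k))
  (logc   : ∀ k → a k * a (2 + k) ≤ a (suc k) * a (suc k)) where

  -- Log-concavity passes a descent on only after cancelling `a j`, so positivity up to `N` is
  -- carried along in the induction.
  descends : ∀ {m} → a (suc m) < a m → ∀ i → m ≤ i → a (suc i) ≤ a i × (i ≤ N → 0 < a i)
  descends {m} d i m≤i with m≤n⇒m<n∨m≡n m≤i
  ... | inj₂ refl = <⇒≤ d , λ _ → ≤-<-trans z≤n d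
  ... | inj₁ (s≤s {n = j} m≤j) with j <? N | descends d j m≤j
  ...   | no  j≮N | _ , _ = subst (_≤ a (suc j)) (sym (beyond (2 + j) (s≤s (m≤n⇒m≤1+n (≮⇒≥ j≮N))))) z≤n
                          , λ j<N → contradiction j<N j≮N
  ...   | yes j<N | h , positive = *-cancelˡ-≤ (a j) {{>-nonZero aj>0}} (begin
              a j * a (2 + j)           ≤⟨ logc j ⟩
              a (suc j) * a (suc j)     ≤⟨ *-monoˡ-≤ (a (suc j)) h ⟩
              a j * a (suc j)           ∎)
            , λ _ → up j aj>0 j<N
    where
    open ≤-Reasoning
    aj>0 : 0 < a j
    aj>0 = positive (<⇒≤ j<N)

  -- A bounded search for the first strict descent, which keeps the choice of the mode constructive.
  ascent-or-peak : ∀ M → (∀ i → suc i ≤ M → a i ≤ a (suc i)) ⊎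
    (∃[ m ] (∀ i → suc i ≤ m → a i ≤ a (suc i)) × a (suc m) < a m)
  ascent-or-peak zero = inj₁ λ _ ()
  ascent-or-peak (suc M) with ascent-or-peak M
  ... | inj₂ p = inj₂ p
  ... | inj₁ h with a M ≤? a (suc M)
  ...   | no  p = inj₂ (M , h , ≰⇒> p)
  ...   | yes p = inj₁ extend
    where
    extend : ∀ i → suc i ≤ suc M → a i ≤ a (suc i)
    extend i (s≤s i≤M) with m≤n⇒m<n∨m≡n i≤M
    ... | inj₁ i<M  = h i i<M
    ... | inj₂ refl = p

  logConcave⇒unimodal : Unimodal a
  logConcave⇒unimodal with ascent-or-peak (suc N)
  ... | inj₂ (m , h , d) = m , h , λ i m≤i → proj₁ (descends d i m≤i)
  ... | inj₁ h           = suc N , h , λ i N<i →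
        subst (_≤ a i) (sym (beyond (suc i) (m≤n⇒m≤1+n N<i))) z≤n

-- The Euler operator h ↦ (n ↦ n * h n)

-- The Leibniz rule for `x d/dx` on generating functions: the factor `x^s` contributes `s x^s`.
shift-euler : ∀ s h n → n * shift s h n ≡ shift s (λ m → m * h m) n + s * shift s h n
shift-euler zero    h n       = sym (+-identityʳ _)
shift-euler (suc s) h zero    = sym (*-zeroʳ (suc s))
shift-euler (suc s) h (suc n) rewrite shift-euler s h n = arith (shift s h n) (shift s (λ m → m * h m) n) s
  where
  arith : ∀ x y s → x + (y + s * x) ≡ y + (x + s * x)
  arith = solve-∀

-- Multiplication by `x + 2 x^2 + ... + M x^M`, the Euler derivative of the window.
convSteps : ℕ → (ℕ → ℕ) → ℕ → ℕ
convSteps M h n = ∑ M (λ i → suc i * shift (suc i) h n)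

conv-euler : ∀ M h n → n * conv M h n ≡ conv M (λ m → m * h m) n + convSteps M h n
conv-euler M h n = trans (sym (∑-*ˡ M n _)) (trans (∑-cong M λ i → shift-euler (suc i) h n) (∑-+ M _ _))

conv-convSteps : ∀ M M′ h n → conv M (convSteps M′ h) n ≡ convSteps M′ (conv M h) n
conv-convSteps M M′ h n = trans (conv-∑ M M′ _ n)
  (∑-cong M′ λ i → trans (conv-*ˡ M (suc i) _ n) (cong (suc i *_) (conv-shift M (suc i) h n)))

pow-convSteps : ∀ M h k n → pow M (convSteps M h) k n ≡ convSteps M (pow M h k) n
pow-convSteps M h zero    n = refl
pow-convSteps M h (suc k) n = trans (conv-cong M (pow-convSteps M h k) n) (conv-convSteps M M (pow M h k) n)

n*δ : ∀ n → n * δ n ≡ 0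
n*δ zero    = refl
n*δ (suc n) = *-zeroʳ n

conv-zero : ∀ M n → conv M (λ _ → 0) n ≡ 0
conv-zero M n = conv-*ˡ M 0 (λ _ → 0) n

-- The power rule for the Euler operator, applied to the `(k+1)`-st power of the window; the factor
-- `δ` is annihilated.
pow-euler : ∀ M k n → n * comp M (suc k) n ≡ suc k * pow M (convSteps M δ) k n
pow-euler M zero n = begin
  n * conv M δ n                                        ≡⟨ conv-euler M δ n ⟩
  conv M (λ m → m * δ m) n + convSteps M δ n            ≡⟨ cong (_+ convSteps M δ n) 
                                                              (trans (conv-cong M n*δ n) (conv-zero M n)) ⟩
  convSteps M δ n                                       ≡⟨ sym (*-identityˡ _) ⟩
  1 * convSteps M δ n                                   ∎
  where open ≡-Reasoning
pow-euler M (suc k) n = begin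
  n * conv M f n                                        ≡⟨ conv-euler M f n ⟩
  conv M (λ m → m * f m) n + convSteps M f n            ≡⟨ cong₂ _+_ (conv-cong M (pow-euler M k) n)
                                                              (sym (pow-convSteps M δ (suc k) n)) ⟩
  conv M (λ m → suc k * w m) n + pow M (convSteps M δ) (suc k) n ≡⟨ cong (_+ conv M w n) (conv-*ˡ M (suc k) w n) ⟩
  suc k * conv M w n + conv M w n                       ≡⟨ +-comm _ (conv M w n) ⟩
  (2 + k) * conv M w n                                  ∎
  where
  open ≡-Reasoning
  f = comp M (suc k)
  w = pow M (convSteps M δ) k

pow-cong : ∀ M {f g} → (∀ m → f m ≡ g m) → ∀ k n → pow M f k n ≡ pow M g k n
pow-cong M e zero    n = e n
pow-cong M e (suc k) n = conv-cong M (pow-cong M e k) n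

pow-∑ : ∀ M K (h : ℕ → ℕ → ℕ) k n → pow M (λ m → ∑ K (λ j → h j m)) k n ≡ ∑ K (λ j → pow M (h j) k n)
pow-∑ M K h zero    n = refl
pow-∑ M K h (suc k) n = trans (conv-cong M (pow-∑ M K h k) n) (conv-∑ M K (λ j → pow M (h j) k) n)

pow-shift : ∀ M s h k n → pow M (shift s h) k n ≡ shift s (pow M h k) n
pow-shift M s h zero    n = refl
pow-shift M s h (suc k) n = trans (conv-cong M (pow-shift M s h k) n) (conv-shift M s (pow M h k) n)

-- Counting words by their gaps

countL-cong : ∀ {A : Set} {p q : A → Bool} → (∀ x → p x ≡ q x) → ∀ xs → countL p xs ≡ countL q xs
countL-cong e []       = refl
countL-cong e (x ∷ xs) rewrite e x | countL-cong e xs = refl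

countL-++ : ∀ {A : Set} (p : A → Bool) xs ys → countL p (xs ++ ys) ≡ countL p xs + countL p ys
countL-++ p []       ys = refl
countL-++ p (x ∷ xs) ys with p x
... | true  = cong suc (countL-++ p xs ys)
... | false = countL-++ p xs ys

countL-map : ∀ {A B : Set} (p : B → Bool) (f : A → B) xs → countL p (map f xs) ≡ countL (p ∘ f) xs
countL-map p f []       = refl
countL-map p f (x ∷ xs) with p (f x)
... | true  = cong suc (countL-map p f xs)
... | false = countL-map p f xs

countL-false : ∀ {A : Set} {p : A → Bool} → (∀ x → p x ≡ false) → ∀ xs → countL p xs ≡ 0
countL-false e []       = refl
countL-false e (x ∷ xs) rewrite e x = countL-false e xs

count : ∀ n → (Subset n → Bool) → ℕ → ℕ
count n q k = countL (λ D → q D ∧ (∣ D ∣ ≡ᵇ k)) (allSubsets n)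

count-cong : ∀ n {p q : Subset n → Bool} → (∀ D → p D ≡ q D) → ∀ k → count n p k ≡ count n q k
count-cong n e k = countL-cong (λ D → cong (_∧ (∣ D ∣ ≡ᵇ k)) (e D)) (allSubsets n)

count-split : ∀ n (q : Subset (suc n) → Bool) k → count (suc n) q k ≡
  countL (λ D → q (true ∷ᵛ D) ∧ (suc ∣ D ∣ ≡ᵇ k)) (allSubsets n) + count n (q ∘ (false ∷ᵛ_)) k
count-split n q k = trans (countL-++ _ (map (true ∷ᵛ_) (allSubsets n)) _)
  (cong₂ _+_ (countL-map _ (true ∷ᵛ_) (allSubsets n)) (countL-map _ (false ∷ᵛ_) (allSubsets n)))

count-suc : ∀ n (q : Subset (suc n) → Bool) k →
  count (suc n) q (suc k) ≡ count n (q ∘ (true ∷ᵛ_)) k + count n (q ∘ (false ∷ᵛ_)) (suc k)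
count-suc n q k = count-split n q (suc k)

count-zero : ∀ n (q : Subset (suc n) → Bool) → count (suc n) q 0 ≡ count n (q ∘ (false ∷ᵛ_)) 0
count-zero n q = trans (count-split n q 0)
  (cong (_+ count n (q ∘ (false ∷ᵛ_)) 0) (countL-false (λ D → ∧-zeroʳ (q (true ∷ᵛ D))) (allSubsets n)))

count-never : ∀ n {q : Subset n → Bool} → (∀ D → q D ≡ false) → ∀ k → count n q k ≡ 0
count-never n e k = countL-false (λ D → cong (_∧ (∣ D ∣ ≡ᵇ k)) (e D)) (allSubsets n)

-- gap b e r v: at most r falses may precede the first true of v, at most b lie between consecutive
-- trues, and an allowance of e must remain at the end.
gap : ℕ → ℕ → ℕ → ∀ {n} → Vec Bool n → Bool
gap b e r       []ᵛ         = e ≤ᵇ r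
gap b e r       (true  ∷ᵛ v) = gap b e b v
gap b e zero    (false ∷ᵛ v) = false
gap b e (suc r) (false ∷ᵛ v) = gap b e r v

count-gap-zero : ∀ b e r n → count n (gap b e r) 0 ≡ ind e r n
count-gap-zero b e r zero rewrite +-identityʳ e with e ≤ᵇ r
... | true  = refl
... | false = refl
count-gap-zero b e zero (suc n) = trans (count-zero n (gap b e zero))
  (trans (count-never n (λ _ → refl) 0) (sym (ind-zero {e} {0} {suc n} (≤-trans (s≤s z≤n) (m≤n+m (suc n) e)))))
count-gap-zero b e (suc r) (suc n) = trans (count-zero n (gap b e (suc r)))
  (trans (count-gap-zero b e r n) (ind-suc e r n))
  where
  ind-suc : ∀ e r n → ind e r n ≡ ind e (suc r) (suc n)
  ind-suc e r n with e + n ≤? r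
  ... | yes p = trans (ind-one {e} p) (sym (ind-one {e} (≤-trans (≤-reflexive (+-suc e n)) (s≤s p))))
  ... | no  p = trans (ind-zero {e} (≰⇒> p)) (sym (ind-zero {e} (≤-trans (s≤s (≰⇒> p)) (≤-reflexive (sym (+-suc e n))))))

-- The first true stands at one of the positions 0 to `r`; after it the count starts afresh with
-- allowance `b`.
count-gap-suc : ∀ b e r n k →
  count n (gap b e r) (suc k) ≡ conv (suc r) (λ m → count m (gap b e b) k) n
count-gap-suc b e r       zero    k = trans (empty (e ≤ᵇ r)) (sym (∑-zero (suc r)))
  where
  empty : ∀ x → (if x ∧ false then 1 else 0) ≡ 0
  empty x = cong χ (∧-zeroʳ x)
count-gap-suc b e zero    (suc n) k = trans (count-suc n (gap b e zero) k)
  (cong (count n (gap b e b) k +_) (count-never n (λ _ → refl) (suc k)))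
count-gap-suc b e (suc r) (suc n) k = trans (count-suc n (gap b e (suc r)) k)
  (cong (count n (gap b e b) k +_) (count-gap-suc b e r n k))

count-gap : ∀ b e k n → count n (gap b e b) k ≡ pow (suc b) (ind e b) k n
count-gap b e zero    n = count-gap-zero b e b n
count-gap b e (suc k) n = trans (count-gap-suc b e b n k) (conv-cong (suc b) (count-gap b e k) n)

-- j counts the falses before the first true: the final gap wraps around and absorbs them.
cyclic : ℕ → ℕ → ∀ {n} → Vec Bool n → Bool
cyclic b j []ᵛ          = false
cyclic b j (true  ∷ᵛ v) = gap b j b v
cyclic b j (false ∷ᵛ v) = cyclic b (suc j) v

-- Here `i` is the number of falses before the first true. Any `K ≥ n` serves because longer shifts
-- vanish, and a fixed `K` lets the sum be exchanged with `pow`.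
count-cyclic-suc : ∀ b j n k K → n ≤ K → count n (cyclic b j) (suc k) ≡
  ∑ K (λ i → shift (suc i) (pow (suc b) (ind (j + i) b) k) n)
count-cyclic-suc b j zero    k K       _         = sym (∑-zero K)
count-cyclic-suc b j (suc n) k (suc K) (s≤s n≤K) = begin
  count (suc n) (cyclic b j) (suc k)
    ≡⟨ count-suc n (cyclic b j) k ⟩
  count n (gap b j b) k + count n (cyclic b (suc j)) (suc k)
    ≡⟨ cong₂ _+_ (trans (count-gap b j k n) (cong (λ e → pow (suc b) (ind e b) k n) (sym (+-identityʳ j))))
                 (count-cyclic-suc b (suc j) n k K n≤K) ⟩
  pow (suc b) (ind (j + 0) b) k n + ∑ K (λ i → shift (suc i) (pow (suc b) (ind (suc j + i) b) k) n)
    ≡⟨ cong (pow (suc b) (ind (j + 0) b) k n +_) (∑-cong K λ i →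
         cong (λ e → shift (suc i) (pow (suc b) (ind e b) k) n) (sym (+-suc j i))) ⟩
  ∑ (suc K) (λ i → shift (suc i) (pow (suc b) (ind (j + i) b) k) (suc n)) ∎
  where open ≡-Reasoning

-- Shift and offset cancel: every term with `i < m` equals `h (m - 1)`, the others are 0.
∑-diagonal : ∀ K (h : ℕ → ℕ) m → 
  ∑ K (λ i → shift (suc i) (λ x → h (i + x)) m) ≡ (K ⊓ m) * h (pred m)
∑-diagonal zero    h m       = refl
∑-diagonal (suc K) h zero    = ∑-zero K
∑-diagonal (suc K) h (suc m) = cong (h m +_) (trans (∑-diagonal K (h ∘ suc) m) (last m))
  where
  last : ∀ m → (K ⊓ m) * h (suc (pred m)) ≡ (K ⊓ m) * h m
  last zero    rewrite ⊓-zeroʳ K = refl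
  last (suc m) = refl

∑-shift-δ : ∀ K m → ∑ K (λ i → shift i δ m) ≡ χ (m <ᵇ K)
∑-shift-δ zero    m       = refl
∑-shift-δ (suc K) zero    = cong suc (∑-zero K)
∑-shift-δ (suc K) (suc m) = ∑-shift-δ K m

-- The part of size m that contains the cut arises once for each number i < m of vertices of the gap
-- that precede the first true.
diagonal-steps : ∀ b K m → suc b ≤ K →
  ∑ K (λ i → shift (suc i) (ind i b) m) ≡ convSteps (suc b) δ m
diagonal-steps b K m b<K = begin
  ∑ K (λ i → shift (suc i) (ind i b) m)   ≡⟨ ∑-diagonal K (λ x → χ (x ≤ᵇ b)) m ⟩
  (K ⊓ m) * χ (pred m ≤ᵇ b)               ≡⟨ value m ⟩
  m * conv (suc b) δ m                    ≡⟨ pow-euler (suc b) 0 m ⟩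
  1 * convSteps (suc b) δ m               ≡⟨ *-identityˡ _ ⟩
  convSteps (suc b) δ m                   ∎
  where
  open ≡-Reasoning
  value : ∀ m → (K ⊓ m) * χ (pred m ≤ᵇ b) ≡ m * conv (suc b) δ m
  value zero rewrite ⊓-zeroʳ K = refl
  value (suc m) rewrite ∑-shift-δ (suc b) m with m ≤? b
  ... | yes p rewrite ≤ᵇ-true p | ≤ᵇ-true (s≤s p) = cong (_* 1) (m≥n⇒m⊓n≡n (≤-trans (s≤s p) b<K))
  ... | no  p rewrite ≤ᵇ-false (≰⇒> p) | ≤ᵇ-false (s≤s (≰⇒> p)) = trans (*-zeroʳ (K ⊓ suc m)) (sym (*-zeroʳ m))

-- The part through the cut is counted with its size as weight, which gives
-- `pow M (convSteps M δ) k`; the power rule identifies this, up to the factor `k + 1`, with `n`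
-- times the compositions.
count-cyclic : ∀ b n k → suc k * count n (cyclic b 0) (suc k) ≡ n * comp (suc b) (suc k) n
count-cyclic b n k = begin
  suc k * count n (cyclic b 0) (suc k)
    ≡⟨ cong (suc k *_) (count-cyclic-suc b 0 n k K (m≤n+m n (suc b))) ⟩
  suc k * ∑ K (λ i → shift (suc i) (pow M (ind i b) k) n)
    ≡⟨ cong (suc k *_) (∑-cong K λ i → sym (pow-shift M (suc i) (ind i b) k n)) ⟩
  suc k * ∑ K (λ i → pow M (shift (suc i) (ind i b)) k n)
    ≡⟨ cong (suc k *_) (sym (pow-∑ M K (λ i → shift (suc i) (ind i b)) k n)) ⟩
  suc k * pow M (λ m → ∑ K (λ i → shift (suc i) (ind i b) m)) k n
    ≡⟨ cong (suc k *_) (pow-cong M (λ m → diagonal-steps b K m (m≤m+n (suc b) n)) k n) ⟩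
  suc k * pow M (convSteps M δ) k n
    ≡⟨ sym (pow-euler M k n) ⟩
  n * comp M (suc k) n ∎
  where
  open ≡-Reasoning
  M = suc b
  -- At least `n` for `count-cyclic-suc` and at least `suc b` for `diagonal-steps`.
  K = suc b + n

-- Domination as a gap condition

bool-ext : ∀ {b b′} → (b ≡ true → b′ ≡ true) → (b′ ≡ true → b ≡ true) → b ≡ b′
bool-ext {true}  {b′}    f g = sym (f refl)
bool-ext {false} {true}  f g = g refl
bool-ext {false} {false} f g = refl

∧-true : ∀ {b b′} → b ∧ b′ ≡ true → b ≡ true × b′ ≡ true
∧-true {true} e = refl , e

≤ᵇ-true⁻ : ∀ {m n} → (m ≤ᵇ n) ≡ true → m ≤ n
≤ᵇ-true⁻ {m} {n} e = ≤ᵇ⇒≤ m n (subst T (sym e) _)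

allL⁺ : ∀ {A : Set} {p : A → Bool} xs → (∀ x → p x ≡ true) → allL p xs ≡ true
allL⁺ []       h = refl
allL⁺ (x ∷ xs) h rewrite h x = allL⁺ xs h

allL⁻ : ∀ {A : Set} {p : A → Bool} {x xs} → allL p xs ≡ true → x ∈ xs → p x ≡ true
allL⁻ e (here refl) = proj₁ (∧-true e)
allL⁻ e (there x∈)  = allL⁻ (proj₂ (∧-true e)) x∈

anyL⁺ : ∀ {A : Set} {p : A → Bool} {x xs} → x ∈ xs → p x ≡ true → anyL p xs ≡ true
anyL⁺ (here refl) e rewrite e = refl
anyL⁺ {p = p} (there {x = y} x∈) e rewrite anyL⁺ {p = p} x∈ e = ∨-zeroʳ (p y)

anyL⁻ : ∀ {A : Set} {p : A → Bool} xs → anyL p xs ≡ true → ∃[ x ] p x ≡ true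
anyL⁻ {p = p} (x ∷ xs) e with p x in q
... | true  = x , q
... | false = anyL⁻ xs e

module _ {n} (d : Fin n → Fin n → ℕ) (ℓ : ℕ) (d-refl : ∀ v → d v v ≡ 0) (D : Subset n) where

  private
    Covered : Set
    Covered = ∀ v → ∃[ u ] lookup D u ≡ true × d v u ≤ ℓ

  -- As `d v v = 0`, membership and adjacency merge into one condition: some member lies within
  -- distance `ℓ`.
  dominating⁻ : isDominating (powerOf d ℓ) D ≡ true → Covered
  dominating⁻ e v with lookup D v in Dv | allL⁻ e (∈-allFin v)
  ... | true  | _ = v , Dv , subst (_≤ ℓ) (sym (d-refl v)) z≤n
  ... | false | h with anyL⁻ (allFin n) h
  ...   | u , k with ∧-true {lookup D u} k
  ...     | Du , k′ = u , Du , ≤ᵇ-true⁻ (proj₂ (∧-true k′))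

  dominating⁺ : Covered → isDominating (powerOf d ℓ) D ≡ true
  dominating⁺ h = allL⁺ (allFin n) covered
    where
    covered : ∀ v → lookup D v ∨ anyL (λ u → lookup D u ∧ powerOf d ℓ v u) (allFin n) ≡ true
    covered v with lookup D v in Dv | h v
    ... | true  | _ = refl
    ... | false | u , Du , du = anyL⁺ (∈-allFin u) adjacent
      where
      adjacent : lookup D u ∧ (not (does (v ≟ u)) ∧ (d v u ≤ᵇ ℓ)) ≡ true
      adjacent with v ≟ u
      ... | yes refl = contradiction (trans (sym Dv) Du) λ ()
      ... | no  _    rewrite Du = ≤ᵇ-true du

-- Positions, windows and gaps

At : ∀ {n} → Vec Bool n → ℕ → Set
At []ᵛ     _       = ⊥
At (b ∷ᵛ _) zero    = b ≡ true
At (_ ∷ᵛ v) (suc j) = At v j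

At-< : ∀ {n} (v : Vec Bool n) j → At v j → j < n
At-< (_ ∷ᵛ v) zero    _ = z<s
At-< (_ ∷ᵛ v) (suc j) h = s≤s (At-< v j h)

At-lookup : ∀ {n} (v : Vec Bool n) (i : Fin n) → lookup v i ≡ true → At v (toℕ i)
At-lookup (_ ∷ᵛ v) zero    e = e
At-lookup (_ ∷ᵛ v) (suc i) e = At-lookup v i e

lookup-At : ∀ {n} (v : Vec Bool n) j → At v j → ∃[ i ] lookup v i ≡ true × toℕ i ≡ j
lookup-At (_ ∷ᵛ v) zero    e = zero , e , refl
lookup-At (_ ∷ᵛ v) (suc j) e with lookup-At v j e
... | i , h , k = suc i , h , cong suc k

-- For b = ℓ + ℓ, Window b q (p + ℓ) says that p and q differ by at most ℓ, without subtraction.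
Window : ℕ → ℕ → ℕ → Set
Window b q x = q ≤ x × x ≤ q + b

-- For `r = e = ℓ` the points `x = p + ℓ` run through the vertices `p < n`; general `r` and `e`
-- serve the induction and the cyclic case.
Spec : ℕ → ℕ → ℕ → ∀ {n} → Vec Bool n → Set
Spec b e r {n} v = ∀ x → r ≤ x → x < e + n → ∃[ j ] At v j × Window b j x

gap⇒Spec : ∀ b e r {n} (v : Vec Bool n) → gap b e r v ≡ true → Spec b e r v
gap⇒Spec b e r []ᵛ h x r≤x x<e rewrite +-identityʳ e =
  contradiction (≤-trans (≤ᵇ-true⁻ h) r≤x) (<⇒≱ x<e)
gap⇒Spec b e r {suc n} (true ∷ᵛ v) h x r≤x x<e with x ≤? b
... | yes x≤b = 0 , refl , z≤n , x≤b
gap⇒Spec b e r {suc n} (true ∷ᵛ v) h zero    r≤x x<e | no x≰b = contradiction z≤n x≰b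
gap⇒Spec b e r {suc n} (true ∷ᵛ v) h (suc x) r≤x x<e | no x≰b
  with gap⇒Spec b e b v h x (s≤s⁻¹ (≰⇒> x≰b)) (s≤s⁻¹ (subst (suc x <_) (+-suc e n) x<e))
... | j , a , lo , hi = suc j , a , s≤s lo , s≤s hi
gap⇒Spec b e (suc r) {suc n} (false ∷ᵛ v) h (suc x) (s≤s r≤x) x<e
  with gap⇒Spec b e r v h x r≤x (s≤s⁻¹ (subst (suc x <_) (+-suc e n) x<e))
... | j , a , lo , hi = suc j , a , s≤s lo , s≤s hi

-- A failed check contradicts `Spec` at a single point: `x = r` at the end of the vector, `x = 0` at
-- a false met with no allowance left.
Spec⇒gap : ∀ b e r {n} (v : Vec Bool n) → r ≤ b → Spec b e r v → gap b e r v ≡ true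
Spec⇒gap b e r []ᵛ r≤b s = ≤ᵇ-true (≮⇒≥ λ r<e →
  proj₁ (proj₂ (s r ≤-refl (subst (r <_) (sym (+-identityʳ e)) r<e))))
Spec⇒gap b e r {suc n} (true ∷ᵛ v) r≤b s = Spec⇒gap b e b v ≤-refl tail
  where
  tail : Spec b e b v
  tail x b≤x x<e with s (suc x) (≤-trans r≤b (m≤n⇒m≤1+n b≤x)) (subst (suc x <_) (sym (+-suc e n)) (s≤s x<e))
  ... | zero  , _ , _  , hi = contradiction hi (<⇒≱ (s≤s b≤x))
  ... | suc j , a , lo , hi = j , a , s≤s⁻¹ lo , s≤s⁻¹ hi
Spec⇒gap b e zero {suc n} (false ∷ᵛ v) r≤b s with s 0 z≤n (≤-trans (s≤s z≤n) (m≤n+m (suc n) e))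
... | zero  , () , _
... | suc j , _ , () , _
Spec⇒gap b e (suc r) {suc n} (false ∷ᵛ v) r≤b s = Spec⇒gap b e r v (<⇒≤ r≤b) tail
  where
  tail : Spec b e r v
  tail x r≤x x<e with s (suc x) (s≤s r≤x) (subst (suc x <_) (sym (+-suc e n)) (s≤s x<e))
  ... | zero  , () , _
  ... | suc j , a , lo , hi = j , a , s≤s⁻¹ lo , s≤s⁻¹ hi

dist⇒≤ : ∀ {p q ℓ} → ∣ p - q ∣ ≤ ℓ → p ≤ q + ℓ × q ≤ p + ℓ
dist⇒≤ {p} {q} h = ≤-trans (m≤n+∣m-n∣ p q) (+-monoʳ-≤ q h) , ≤-trans (m≤n+∣n-m∣ q p) (+-monoʳ-≤ p h)

≤⇒dist : ∀ {p q ℓ} → p ≤ q + ℓ → q ≤ p + ℓ → ∣ p - q ∣ ≤ ℓ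
≤⇒dist {p} {q} h k with ≤-total p q
... | inj₁ p≤q rewrite m≤n⇒∣m-n∣≡n∸m p≤q = m≤n+o⇒m∸n≤o q p k
... | inj₂ q≤p rewrite m≤n⇒∣n-m∣≡n∸m q≤p = m≤n+o⇒m∸n≤o p q h

dist⇒Window : ∀ {p q ℓ} → ∣ p - q ∣ ≤ ℓ → Window (ℓ + ℓ) q (p + ℓ)
dist⇒Window {p} {q} {ℓ} h with dist⇒≤ {p} {q} {ℓ} h
... | a , b = b , lin 0 a (solve (p ∷ q ∷ ℓ ∷ []))

Window⇒dist : ∀ {p q ℓ} → Window (ℓ + ℓ) q (p + ℓ) → ∣ p - q ∣ ≤ ℓ
Window⇒dist {p} {q} {ℓ} (a , b) = ≤⇒dist {p} {q} (lin 0 b (solve (p ∷ q ∷ ℓ ∷ []))) a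

path-dominating : ∀ ℓ {n} (D : Subset n) → isDominating (P ℓ n) D ≡ gap (ℓ + ℓ) ℓ ℓ D
path-dominating ℓ {n} D = bool-ext
  (λ e → Spec⇒gap (ℓ + ℓ) ℓ ℓ D (m≤m+n ℓ ℓ) (spec (dominating⁻ pathDist ℓ (λ v → ∣n-n∣≡0 (toℕ v)) D e)))
  (λ e → dominating⁺ pathDist ℓ (λ v → ∣n-n∣≡0 (toℕ v)) D (covered (gap⇒Spec (ℓ + ℓ) ℓ ℓ D e)))
  where
  spec : (∀ v → ∃[ u ] lookup D u ≡ true × pathDist v u ≤ ℓ) → Spec (ℓ + ℓ) ℓ ℓ D
  spec h x ℓ≤x x<n with h (fromℕ< p<n)
    where
    p<n : x ∸ ℓ < n
    p<n = subst (x ∸ ℓ <_) (m+n∸m≡n ℓ n) (∸-monoˡ-< x<n ℓ≤x)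
  ... | u , Du , du rewrite toℕ-fromℕ< (subst (x ∸ ℓ <_) (m+n∸m≡n ℓ n) (∸-monoˡ-< x<n ℓ≤x)) =
    toℕ u , At-lookup D u Du , subst (Window (ℓ + ℓ) (toℕ u)) (m∸n+n≡m ℓ≤x) (dist⇒Window {x ∸ ℓ} {toℕ u} du)
  covered : Spec (ℓ + ℓ) ℓ ℓ D → ∀ v → ∃[ u ] lookup D u ≡ true × pathDist v u ≤ ℓ
  covered s v with s (toℕ v + ℓ) (m≤n+m ℓ (toℕ v)) (subst (toℕ v + ℓ <_) (+-comm n ℓ) (+-monoˡ-< ℓ (toℕ<n v)))
  ... | j , a , w with lookup-At D j a
  ...   | u , Du , refl = u , Du , Window⇒dist {toℕ v} {toℕ u} w

-- Here x is p + ℓ for a vertex p; the three lifts q, q - n and q + n of the vertex q are tested.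
Near : ℕ → ℕ → ℕ → ℕ → Set
Near n b q x = Window b q x ⊎ Window b q (x + n) ⊎ Window b (q + n) x

-- If the minimum is attained by the arc through the cut, then `n ≤ ∣ p - q ∣ + ℓ`, and the order of
-- `p` and `q` decides whether `q` is lifted down or up.
cycleDist⇒Near : ∀ {n p q ℓ} → p < n → q < n → ∣ p - q ∣ ⊓ (n ∸ ∣ p - q ∣) ≤ ℓ → Near n (ℓ + ℓ) q (p + ℓ)
cycleDist⇒Near {n} {p} {q} {ℓ} p<n q<n h with ⊓-sel ∣ p - q ∣ (n ∸ ∣ p - q ∣)
... | inj₁ e = inj₁ (dist⇒Window {p} {q} (subst (_≤ ℓ) e h))
... | inj₂ e with ≤-trans (m≤n+m∸n n ∣ p - q ∣) (+-monoʳ-≤ ∣ p - q ∣ (subst (_≤ ℓ) e h)) | ≤-total p q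
...   | k | inj₁ p≤q rewrite m≤n⇒∣m-n∣≡n∸m p≤q = inj₂ (inj₁
        ( ≤-trans (<⇒≤ q<n) (m≤n+m n (p + ℓ))
        , wrap (q ∸ p) (m∸n+n≡m p≤q) k))
        where
        wrap : ∀ t → t + p ≡ q → n ≤ t + ℓ → p + ℓ + n ≤ q + (ℓ + ℓ)
        wrap t refl k = lin 0 k (solve (t ∷ p ∷ n ∷ ℓ ∷ []))
...   | k | inj₂ q≤p rewrite m≤n⇒∣n-m∣≡n∸m q≤p = inj₂ (inj₂
        ( wrap (p ∸ q) (m∸n+n≡m q≤p) k
        , lin (suc (q + ℓ)) p<n (solve (p ∷ q ∷ n ∷ ℓ ∷ []))))
        where
        wrap : ∀ t → t + q ≡ p → n ≤ t + ℓ → q + n ≤ p + ℓ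
        wrap t refl k = lin 0 k (solve (t ∷ q ∷ n ∷ ℓ ∷ []))

Near⇒cycleDist : ∀ {n p q ℓ} → p < n → q < n → Near n (ℓ + ℓ) q (p + ℓ) → ∣ p - q ∣ ⊓ (n ∸ ∣ p - q ∣) ≤ ℓ
Near⇒cycleDist {n} {p} {q} {ℓ} p<n q<n (inj₁ w) = ≤-trans (m⊓n≤m _ _) (Window⇒dist {p} {q} w)
Near⇒cycleDist {n} {p} {q} {ℓ} p<n q<n (inj₂ w) = ≤-trans (m⊓n≤n _ _) (m≤n+o⇒m∸n≤o n ∣ p - q ∣ (far w))
  where
  far : Window (ℓ + ℓ) q (p + ℓ + n) ⊎ Window (ℓ + ℓ) (q + n) (p + ℓ) → n ≤ ∣ p - q ∣ + ℓ
  far (inj₁ (_ , hi)) = lin 0 (+-mono-≤ (m≤n+∣n-m∣ q p) hi) (arith ∣ p - q ∣)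
    where
    arith : ∀ t → n + (p + t + (q + (ℓ + ℓ))) + 0 ≡ t + ℓ + (q + (p + ℓ + n))
    arith t = solve (t ∷ p ∷ q ∷ n ∷ ℓ ∷ [])
  far (inj₂ (lo , _)) = lin 0 (+-mono-≤ (m≤n+∣m-n∣ p q) lo) (arith ∣ p - q ∣)
    where
    arith : ∀ t → n + (q + t + (p + ℓ)) + 0 ≡ t + ℓ + (p + (q + n))
    arith t = solve (t ∷ p ∷ q ∷ n ∷ ℓ ∷ [])

-- Splits `D` into `a` falses, a true and the rest `v`, recorded by positions of trues instead of an
-- equation between vectors.
record FirstTrue (b j : ℕ) {n} (D : Vec Bool n) : Set where
  constructor firstTrue
  field
    a m   : ℕ
    v     : Vec Bool m
    size  : n ≡ suc (a + m)
    value : cyclic b j D ≡ gap b (j + a) b v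
    At⁻   : ∀ q → At D q → q ≡ a ⊎ ∃[ i ] At v i × q ≡ suc (a + i)
    At-a  : At D a
    At⁺   : ∀ i → At v i → At D (suc (a + i))

findTrue : ∀ b j {n} (D : Vec Bool n) → ((∀ q → ¬ At D q) × cyclic b j D ≡ false) ⊎ FirstTrue b j D
findTrue b j []ᵛ        = inj₁ ((λ _ ()) , refl)
findTrue b j {suc n} (true ∷ᵛ D) =
  inj₂ (firstTrue 0 n D refl (cong (λ e → gap b e b D) (sym (+-identityʳ j))) At⁻ refl (λ _ h → h))
  where
  At⁻ : ∀ q → At (true ∷ᵛ D) q → q ≡ 0 ⊎ ∃[ i ] At D i × q ≡ suc i
  At⁻ zero    _ = inj₁ refl
  At⁻ (suc i) h = inj₂ (i , h , refl)
findTrue b j (false ∷ᵛ D) with findTrue b (suc j) D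
... | inj₁ (none , e) = inj₁ ((λ { (suc q) h → none q h }) , e)
... | inj₂ (firstTrue a m v size value At⁻ At-a At⁺) =
  inj₂ (firstTrue (suc a) m v (cong suc size) (trans value (cong (λ e → gap b e b v) (sym (+-suc j a))))
    At⁻′ At-a At⁺)
  where
  At⁻′ : ∀ q → At (false ∷ᵛ D) q → q ≡ suc a ⊎ ∃[ i ] At v i × q ≡ suc (suc a + i)
  At⁻′ (suc q) h with At⁻ q h
  ... | inj₁ e           = inj₁ (cong suc e)
  ... | inj₂ (i , k , e) = inj₂ (i , k , cong suc e)

module _ (b ℓ a m : ℕ) (v : Vec Bool m) where

  private
    Member : ℕ → Set
    Member q = q ≡ a ⊎ ∃[ i ] At v i × q ≡ suc (a + i)
    Covers : ℕ → Set
    Covers x = ∃[ q ] Member q × Near (suc (a + m)) b q x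
    absurd : ∀ {A : Set} → 1 ≤ 0 → A
    absurd ()

  -- The point `x` of `v` is `suc (a + x)` in `D`, so its vertex is `suc (a + x) - ℓ`, reduced by
  -- the cycle length if too large. In both cases only one of the six combinations of member and
  -- lift is compatible with `b ≤ x < a + m`.
  Covers⇒Spec : b ≡ ℓ + ℓ → (∀ p → p < suc (a + m) → Covers (p + ℓ)) → Spec b a b v
  Covers⇒Spec b≡ h x b≤x x<a+m = main
    where
    direct : Covers (suc (a + x)) → ∃[ j ] At v j × Window b j x
    direct (q , inj₁ refl , inj₁ (_ , hi)) =
      absurd (lin 0 (+-mono-≤ hi b≤x) (solve (a ∷ b ∷ x ∷ [])))
    direct (q , inj₁ refl , inj₂ (inj₁ (_ , hi))) =
      absurd (lin (suc (a + m)) (+-mono-≤ hi b≤x) (solve (a ∷ b ∷ m ∷ x ∷ [])))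
    direct (q , inj₁ refl , inj₂ (inj₂ (lo , _))) =
      absurd (lin 0 (+-mono-≤ lo x<a+m) (solve (a ∷ m ∷ x ∷ [])))
    direct (q , inj₂ (i , vi , refl) , inj₁ (lo , hi)) =
      i , vi , lin 0 lo (solve (a ∷ i ∷ x ∷ [])) , lin 0 hi (solve (a ∷ b ∷ i ∷ x ∷ []))
    direct (q , inj₂ (i , vi , refl) , inj₂ (inj₁ (_ , hi))) =
      absurd (lin (suc a) (+-mono-≤ hi (+-mono-≤ (At-< v i vi) b≤x)) (solve (a ∷ b ∷ m ∷ i ∷ x ∷ [])))
    direct (q , inj₂ (i , vi , refl) , inj₂ (inj₂ (lo , _))) =
      absurd (lin (suc i) (+-mono-≤ lo x<a+m) (solve (a ∷ m ∷ i ∷ x ∷ [])))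
    wrapped : ∀ y → y + m ≡ x → Covers y → ∃[ j ] At v j × Window b j x
    wrapped y refl (q , inj₁ refl , inj₁ (lo , _)) =
      absurd (lin 0 (+-mono-≤ lo x<a+m) (solve (a ∷ m ∷ y ∷ [])))
    wrapped y refl (q , inj₁ refl , inj₂ (inj₁ (_ , hi))) =
      absurd (lin 0 (+-mono-≤ hi b≤x) (solve (a ∷ b ∷ m ∷ y ∷ [])))
    wrapped y refl (q , inj₁ refl , inj₂ (inj₂ (lo , _))) =
      absurd (lin (suc (a + m)) (+-mono-≤ lo x<a+m) (solve (a ∷ m ∷ y ∷ [])))
    wrapped y refl (q , inj₂ (i , vi , refl) , inj₁ (lo , _)) =
      absurd (lin (suc i) (+-mono-≤ lo x<a+m) (solve (a ∷ m ∷ i ∷ y ∷ [])))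
    wrapped y refl (q , inj₂ (i , vi , refl) , inj₂ (inj₁ (lo , hi))) =
      i , vi , lin 0 lo (solve (a ∷ m ∷ i ∷ y ∷ [])) , lin 0 hi (solve (a ∷ b ∷ m ∷ i ∷ y ∷ []))
    wrapped y refl (q , inj₂ (i , vi , refl) , inj₂ (inj₂ (lo , _))) =
      absurd (lin (suc (suc (a + i + m))) (+-mono-≤ lo x<a+m) (solve (a ∷ m ∷ i ∷ y ∷ [])))
    main : ∃[ j ] At v j × Window b j x
    main with suc (a + x) ∸ ℓ in e
    ... | y with m∸n+n≡m {suc (a + x)} {ℓ} ℓ≤
      where
      ℓ≤ : ℓ ≤ suc (a + x)
      ℓ≤ = ≤-trans (m≤m+n ℓ ℓ) (≤-trans (≤-reflexive (sym b≡)) (≤-trans b≤x (m≤n⇒m≤1+n (m≤n+m x a))))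
    ...   | sum rewrite e with y <? suc (a + m)
    ...     | yes y<n = direct (subst Covers sum (h y y<n))
    ...     | no  y≮n = wrapped (z + ℓ) (unwrap z z+n≡y sum) (h z (below z z+n≡y sum))
      where
      z = y ∸ suc (a + m)
      z+n≡y = m∸n+n≡m (≮⇒≥ y≮n)
      unwrap : ∀ z {y} → z + suc (a + m) ≡ y → y + ℓ ≡ suc (a + x) → z + ℓ + m ≡ x
      unwrap z refl eq = +-cancelˡ-≡ (suc a) (z + ℓ + m) x (trans (regroup a z ℓ m) eq)
        where
        regroup : ∀ a z ℓ m → suc a + (z + ℓ + m) ≡ z + suc (a + m) + ℓ
        regroup = solve-∀
      below : ∀ z {y} → z + suc (a + m) ≡ y → y + ℓ ≡ suc (a + x) → z < suc (a + m)
      below z refl eq = lin (suc (ℓ + m)) (+-mono-≤ (≤-reflexive eq) x<a+m) (solve (a ∷ z ∷ ℓ ∷ m ∷ x ∷ []))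

  -- With `n = suc (a + m)`, `Spec` is needed only if `p + ℓ` or `p + ℓ + n` lies strictly between
  -- `a + b` and `a + n`; otherwise a lift of the first true covers the point.
  Spec⇒Covers : b ≡ ℓ + ℓ → Spec b a b v → ∀ p → p < suc (a + m) → Covers (p + ℓ)
  Spec⇒Covers refl s p p<n with p + ℓ <? a | p + ℓ ≤? a + b | p + ℓ <? a + suc (a + m)
  ... | yes x<a | _ | _ with p + ℓ + suc (a + m) ≤? a + b
  ...   | yes q = a , inj₁ refl , inj₂ (inj₁ (lin (suc (p + ℓ + m)) (≤-refl {0}) (solve (a ∷ p ∷ ℓ ∷ m ∷ [])) , q))
  ...   | no  q with s (p + ℓ + m)
      (lin 0 (≰⇒> q) (solve (a ∷ p ∷ ℓ ∷ m ∷ []))) (lin 0 x<a (solve (a ∷ p ∷ ℓ ∷ m ∷ [])))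
  ...     | i , vi , lo , hi = suc (a + i) , inj₂ (i , vi , refl) , inj₂ (inj₁
            (lin 0 lo (solve (a ∷ p ∷ ℓ ∷ m ∷ i ∷ [])) , lin 0 hi (solve (a ∷ p ∷ ℓ ∷ m ∷ i ∷ []))))
  Spec⇒Covers refl s p p<n | no x≮a | yes x≤ | _ = a , inj₁ refl , inj₁ (≮⇒≥ x≮a , x≤)
  Spec⇒Covers refl s p p<n | no x≮a | no x≰ | no x≮ = a , inj₁ refl , inj₂ (inj₂
    (≮⇒≥ x≮ , lin (suc (a + ℓ)) p<n (solve (a ∷ p ∷ ℓ ∷ m ∷ []))))
  Spec⇒Covers refl s p p<n | no x≮a | no x≰ | yes x< = shifted (p + ℓ) (≰⇒> x≰) x<
    where
    shifted : ∀ x → a + b < x → x < a + suc (a + m) → Covers x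
    shifted x lo hi with x ∸ suc a | m+[n∸m]≡n {suc a} {x} (≤-trans (s≤s (m≤m+n a b)) lo)
    ... | y | refl with s y (lin 0 lo (solve (a ∷ y ∷ ℓ ∷ []))) (lin 0 hi (solve (a ∷ y ∷ m ∷ [])))
    ...   | i , vi , w , w′ = suc (a + i) , inj₂ (i , vi , refl) , inj₁
            (lin 0 w (solve (a ∷ y ∷ i ∷ [])) , lin 0 w′ (solve (a ∷ y ∷ i ∷ ℓ ∷ [])))

cycle-dominating : ∀ ℓ {n} (D : Subset (suc n)) → isDominating (C ℓ (suc n)) D ≡ cyclic (ℓ + ℓ) 0 D
cycle-dominating ℓ {n} D = bool-ext
  (λ e → to (findTrue b 0 D) (dominating⁻ cycleDist ℓ cycleDist-refl D e))
  (λ e → dominating⁺ cycleDist ℓ cycleDist-refl D (from (findTrue b 0 D) e))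
  where
  b = ℓ + ℓ
  cycleDist-refl : ∀ v → cycleDist v v ≡ 0
  cycleDist-refl v rewrite ∣n-n∣≡0 (toℕ v) = refl
  Covered : Set
  Covered = ∀ v → ∃[ u ] lookup D u ≡ true × cycleDist v u ≤ ℓ
  to : ((∀ q → ¬ At D q) × cyclic b 0 D ≡ false) ⊎ FirstTrue b 0 D → Covered → cyclic b 0 D ≡ true
  -- The vertex 0 exists because the cycle is nonempty, and the empty set does not cover it.
  to (inj₁ (none , _)) h with h zero
  ... | u , Du , _ = contradiction (At-lookup D u Du) (none (toℕ u))
  to (inj₂ (firstTrue a m v refl value At⁻ At-a At⁺)) h =
    trans value (Spec⇒gap b a b v ≤-refl (Covers⇒Spec b ℓ a m v refl near))
    where
    near : ∀ p → p < suc (a + m) → ∃[ q ] (q ≡ a ⊎ ∃[ i ] At v i × q ≡ suc (a + i)) × Near (suc (a + m)) b q (p + ℓ)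
    near p p<n with h (fromℕ< p<n)
    ... | u , Du , du rewrite toℕ-fromℕ< p<n =
      toℕ u , At⁻ (toℕ u) (At-lookup D u Du) , cycleDist⇒Near p<n (toℕ<n u) du
  from : ((∀ q → ¬ At D q) × cyclic b 0 D ≡ false) ⊎ FirstTrue b 0 D → cyclic b 0 D ≡ true → Covered
  from (inj₁ (_ , e′)) e = contradiction (trans (sym e) e′) λ ()
  from (inj₂ (firstTrue a m v refl value At⁻ At-a At⁺)) e w
    with Spec⇒Covers b ℓ a m v refl (gap⇒Spec b a b v (trans (sym value) e)) (toℕ w) (toℕ<n w)
  ... | q , mem , near with lookup-At D q (member mem)
    where
    member : ∀ {q} → q ≡ a ⊎ ∃[ i ] At v i × q ≡ suc (a + i) → At D q
    member (inj₁ refl)           = At-a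
    member (inj₂ (i , vi , refl)) = At⁺ i vi
  ...   | u , Du , refl = u , Du , Near⇒cycleDist (toℕ<n w) (toℕ<n u) near

-- Unimodality for paths and cycles

empty-unimodal : (G : Graph 0) → Unimodal (γ G)
empty-unimodal G = 0 , (λ _ ()) , λ _ _ → z≤n

not-positive : ∀ {x} → ¬ 0 < x → x ≡ 0
not-positive h = n≤0⇒n≡0 (≮⇒≥ h)

-- The initial gap gives a window of length `ℓ + 1`, the inner gaps give windows of length `2ℓ + 1`,
-- and the final gap gives the indicator `ind ℓ b`.
path-unimodal : ∀ ℓ n → Unimodal (γ (P ℓ (suc n)))
path-unimodal ℓ n = logConcave⇒unimodal {N = N} beyond up logc
  where
  N = suc n
  b = ℓ + ℓ
  f : ℕ → ℕ → ℕ
  f = pow (suc b) (ind ℓ b)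
  a : ℕ → ℕ
  a = γ (P ℓ N)
  a≡count : ∀ k → a k ≡ count N (gap b ℓ ℓ) k
  a≡count k = count-cong N (path-dominating ℓ) k
  a0 : a 0 ≡ 0
  a0 = trans (a≡count 0) (trans (count-gap-zero b ℓ ℓ N) (ind-zero {ℓ} {ℓ} {N} (m<m+n ℓ z<s)))
  a-suc : ∀ k → a (suc k) ≡ conv (suc ℓ) (f k) N
  a-suc k = trans (a≡count (suc k)) (trans (count-gap-suc b ℓ ℓ N k) (conv-cong (suc ℓ) (count-gap b ℓ k) N))
  supported : ∀ k → Supported k (f k) (f (suc k))
  supported k = pow-supported {ℓ} {b} {suc b} (m≤m+n ℓ ℓ) z<s k
  beyond : ∀ k → N < k → a k ≡ 0
  beyond (suc k) (s≤s N≤k) rewrite a-suc k = not-positive λ p →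
    let x , _ , x<N , q = conv-positive (suc ℓ) (f k) N p
    in <⇒≱ x<N (≤-trans N≤k (Supported.above (supported k) x q))
  up : ∀ k → 0 < a k → k < N → 0 < a (suc k)
  up zero    p _ = contradiction (subst (0 <_) a0 p) λ ()
  up (suc k) p k<N rewrite a-suc k | a-suc (suc k) = conv-next (suc ℓ) (supported k) N p k<N
  logc : ∀ k → a k * a (2 + k) ≤ a (suc k) * a (suc k)
  logc zero    rewrite a0 = z≤n
  logc (suc k) rewrite a-suc k | a-suc (suc k) | a-suc (2 + k) =
    conv-logConcave {f (suc k)} {f k} {suc b} {suc ℓ} N (pow-≽ {ℓ} {b} (n≤1+n b) k) (s≤s (m≤m+n ℓ ℓ))

positive-factor : ∀ m {n} → 0 < m * n → 0 < n
positive-factor m {zero}  p = subst (0 <_) (*-zeroʳ m) p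
positive-factor m {suc n} p = z<s

count-cyclic-zero : ∀ b j n → count n (cyclic b j) 0 ≡ 0
count-cyclic-zero b j zero    = refl
count-cyclic-zero b j (suc n) = trans (count-zero n (cyclic b j)) (count-cyclic-zero b (suc j) n)

-- Clearing denominators gives `(k+3) p r ≤ (k+2) q²`, slightly more than required.
divide-logConcave : ∀ n k p q r x y z →
  suc k * p ≡ n * x → (2 + k) * q ≡ n * y → (3 + k) * r ≡ n * z →
  (2 + k) * (x * z) ≤ suc k * (y * y) → p * r ≤ q * q
divide-logConcave n k p q r x y z ep eq er h =
  *-cancelˡ-≤ (2 + k) (≤-trans (*-monoˡ-≤ (p * r) (n≤1+n (2 + k))) (*-cancelˡ-≤ (suc k * (2 + k)) (begin
    suc k * (2 + k) * ((3 + k) * (p * r))     ≡⟨ solve (k ∷ p ∷ r ∷ []) ⟩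
    (2 + k) * (suc k * p * ((3 + k) * r))     ≡⟨ cong₂ (λ s t → (2 + k) * (s * t)) ep er ⟩
    (2 + k) * (n * x * (n * z))               ≡⟨ solve (k ∷ n ∷ x ∷ z ∷ []) ⟩
    n * n * ((2 + k) * (x * z))               ≤⟨ *-monoʳ-≤ (n * n) h ⟩
    n * n * (suc k * (y * y))                 ≡⟨ solve (k ∷ n ∷ y ∷ []) ⟩
    suc k * (n * y * (n * y))                 ≡⟨ cong (λ s → suc k * (s * s)) (sym eq) ⟩
    suc k * ((2 + k) * q * ((2 + k) * q))     ≡⟨ solve (k ∷ q ∷ []) ⟩
    suc k * (2 + k) * ((2 + k) * (q * q))     ∎)))
  where open ≤-Reasoning

cycle-unimodal : ∀ ℓ n → Unimodal (γ (C ℓ (suc n)))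
cycle-unimodal ℓ n = logConcave⇒unimodal {N = N} beyond up logc
  where
  N = suc n
  M = suc (ℓ + ℓ)
  d : ℕ → ℕ
  d = γ (C ℓ N)
  d0 : d 0 ≡ 0
  d0 = trans (count-cong N (cycle-dominating ℓ) 0) (count-cyclic-zero (ℓ + ℓ) 0 N)
  d-suc : ∀ k → suc k * d (suc k) ≡ N * comp M (suc k) N
  d-suc k = trans (cong (suc k *_) (count-cong N (cycle-dominating ℓ) (suc k))) (count-cyclic (ℓ + ℓ) N k)
  supported : ∀ k → Supported k (comp M k) (comp M (suc k))
  supported k = pow-supported {0} {0} {M} z≤n z<s k
  d⇒c : ∀ k → 0 < d (suc k) → 0 < comp M (suc k) N
  d⇒c k p = positive-factor N (subst (0 <_) (d-suc k) (<-≤-trans p (m≤m+n (d (suc k)) (k * d (suc k)))))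
  c⇒d : ∀ k → 0 < comp M (suc k) N → 0 < d (suc k)
  c⇒d k p = positive-factor (suc k) (subst (0 <_) (sym (d-suc k))
    (<-≤-trans p (m≤m+n (comp M (suc k) N) (n * comp M (suc k) N))))
  beyond : ∀ k → N < k → d k ≡ 0
  beyond (suc k) N<k = not-positive λ p → <⇒≱ N<k (Supported.above (supported (suc k)) N (d⇒c k p))
  up : ∀ k → 0 < d k → k < N → 0 < d (suc k)
  up zero    p _ = contradiction (subst (0 <_) d0 p) λ ()
  up (suc k) p k<N = c⇒d (suc k) (Supported.next (supported (suc k)) N (d⇒c k p) k<N)
  logc : ∀ k → d k * d (2 + k) ≤ d (suc k) * d (suc k)
  logc zero    rewrite d0 = z≤n
  logc (suc k) = divide-logConcave N k (d (1 + k)) (d (2 + k)) (d (3 + k))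
    (comp M (1 + k) N) (comp M (2 + k) N) (comp M (3 + k) N)
    (d-suc k) (d-suc (1 + k)) (d-suc (2 + k)) (strong-logConcave M (suc k) N)

theorem3 : (n ℓ : ℕ) → 1 ≤ ℓ → Unimodal (γ (P ℓ n)) × Unimodal (γ (C ℓ n))
theorem3 zero    ℓ _ = empty-unimodal (P ℓ 0) , empty-unimodal (C ℓ 0)
theorem3 (suc n) ℓ _ = path-unimodal ℓ n , cycle-unimodal ℓ n
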